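{- Let $p$ be a prime and let $c_1,c_2,\lambda\in\mathbf{Q}_p$ with $c_2\neq 0$ and $\lambda\neq 0$. Let $(a_n)_{n\ge 0}$ be the sequence $a_n=(c_1+c_2 n)\lambda^n$, and let $K$ be its Kepler set. Then $$K=\begin{cases}\lambda\left(1+\dfrac{c_2}{c_1}+\left(\dfrac{c_2}{c_1}\right)^2\mathbf{Z}_p\right), & |c_1|_p>|c_2|_p,\\[2mm] \mathbf{Q}_p\setminus \lambda\left(1+p\mathbf{Z}_p\right), & |c_1|_p\le |c_2|_p.\end{cases}$$
   Context: The Kepler set of a sequence $(a_n)_{n\ge0}$ in $\mathbf{Q}_p$ is the closure in $\mathbf{Q}_p$ of the set of consecutive ratios $\{a_{n+1}/a_n : n\ge 0,\ a_n\neq 0\}$. For $x\in\mathbf{Q}_p$ and a set $A\subseteq\mathbf{Q}_p$, $xA=\{xa:a\in A\}$ and $x+A=\{x+a:a\in A\}$. -}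

module Defs where

open import Data.Empty using (⊥-elim)
open import Data.Integer.Base as ℤ using (ℤ; +_; -[1+_])
open import Data.Integer.Divisibility.Signed
import Data.Integer.Properties as ℤ
open import Data.Integer.Tactic.RingSolver using (solve-∀)
open import Data.Nat.Base as ℕ using (ℕ; zero; suc)
open import Data.Nat.Coprimality using (Coprime; coprime-Bézout)
import Data.Nat.Divisibility as ℕ
open import Data.Nat.GCD using (module Bézout)
open import Data.Nat.Primality using (Prime; prime⇒irreducible; prime⇒nonZero)
import Data.Nat.Properties as ℕ
open import Data.Product.Base using (∃-syntax; Σ-syntax; _×_; _,_; proj₁; proj₂)
open import Data.Sum.Base using (inj₁; inj₂)
open import Data.Unit.Base using (⊤; tt)
open import Level using (0ℓ)
open import Relation.Binary.PropositionalEquality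
open import Relation.Nullary using (¬_; yes; no)
open import Relation.Unary using (Pred; _∈_)

module PAdic (p : ℕ) (p-prime : Prime p) where

  p^_ : ℕ → ℤ
  p^ n = (+ p) ℤ.^ n

  infix 4 _≡_mod-p^_

  record _≡_mod-p^_ (a b : ℤ) (n : ℕ) : Set where
    constructor mod
    field p^n∣a-b : p^ n ∣ a ℤ.- b

  open _≡_mod-p^_ public

  module Congruence where
    by : ∀ {d a b} → d ∣ a → a ≡ b → d ∣ b
    by h refl = h

    p^-step : ∀ {n a b} → a ≡ b mod-p^ suc n → a ≡ b mod-p^ n
    p^-step (mod h) = mod (∣-trans (∣n⇒∣m*n (+ p) ∣-refl) h)

    mod-refl : ∀ {n a} → a ≡ a mod-p^ n
    mod-refl {a = a} = mod (by {a = + 0} (divides (+ 0) refl) (sym (ℤ.+-inverseʳ a)))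

    mod-sym : ∀ {n a b} → a ≡ b mod-p^ n → b ≡ a mod-p^ n
    mod-sym {a = a} {b} (mod h) = mod (by (∣m⇒∣-m h) (lem a b))
      where lem : ∀ a b → ℤ.- (a ℤ.- b) ≡ b ℤ.- a
            lem = solve-∀

    mod-trans : ∀ {n a b c} → a ≡ b mod-p^ n → b ≡ c mod-p^ n → a ≡ c mod-p^ n
    mod-trans {a = a} {b} {c} (mod h) (mod k) = mod (by (∣m∣n⇒∣m+n h k) (lem a b c))
      where lem : ∀ a b c → (a ℤ.- b) ℤ.+ (b ℤ.- c) ≡ a ℤ.- c
            lem = solve-∀

    mod-+ : ∀ {n a b c d} → a ≡ b mod-p^ n → c ≡ d mod-p^ n → a ℤ.+ c ≡ b ℤ.+ d mod-p^ n
    mod-+ {a = a} {b} {c} {d} (mod h) (mod k) = mod (by (∣m∣n⇒∣m+n h k) (lem a b c d))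
      where lem : ∀ a b c d → (a ℤ.- b) ℤ.+ (c ℤ.- d) ≡ (a ℤ.+ c) ℤ.- (b ℤ.+ d)
            lem = solve-∀

    mod-* : ∀ {n a b c d} → a ≡ b mod-p^ n → c ≡ d mod-p^ n → a ℤ.* c ≡ b ℤ.* d mod-p^ n
    mod-* {a = a} {b} {c} {d} (mod h) (mod k) =
      mod (by (∣m∣n⇒∣m+n (∣m⇒∣m*n c h) (∣n⇒∣m*n b k)) (lem a b c d))
      where lem : ∀ a b c d → (a ℤ.- b) ℤ.* c ℤ.+ b ℤ.* (c ℤ.- d) ≡ a ℤ.* c ℤ.- b ℤ.* d
            lem = solve-∀

    mod-neg : ∀ {n a b} → a ≡ b mod-p^ n → ℤ.- a ≡ ℤ.- b mod-p^ n
    mod-neg {a = a} {b} (mod h) = mod (by (∣m⇒∣-m h) (lem a b))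
      where lem : ∀ a b → ℤ.- (a ℤ.- b) ≡ (ℤ.- a) ℤ.- (ℤ.- b)
            lem = solve-∀

  open Congruence

  -- ℤₚ = lim ℤ/pⁿℤ: the n-th component is any integer representing the
  -- residue class modulo pⁿ.
  record ℤₚ : Set where
    constructor mkℤₚ
    field
      residue  : ℕ → ℤ
      coherent : ∀ n → residue (suc n) ≡ residue n mod-p^ n

  open ℤₚ public

  infix  4 _≈ᶻ_
  infixl 6 _+ᶻ_
  infixl 7 _*ᶻ_

  record _≈ᶻ_ (x y : ℤₚ) : Set where
    constructor mk≈ᶻ
    field residues : ∀ n → residue x n ≡ residue y n mod-p^ n

  open _≈ᶻ_ public

  fromℤ : ℤ → ℤₚ
  fromℤ a = mkℤₚ (λ _ → a) (λ _ → mod-refl)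

  _+ᶻ_ _*ᶻ_ : ℤₚ → ℤₚ → ℤₚ
  x +ᶻ y = mkℤₚ (λ n → residue x n ℤ.+ residue y n)
                (λ n → mod-+ (coherent x n) (coherent y n))
  x *ᶻ y = mkℤₚ (λ n → residue x n ℤ.* residue y n)
                (λ n → mod-* (coherent x n) (coherent y n))

  -ᶻ_ : ℤₚ → ℤₚ
  -ᶻ x = mkℤₚ (λ n → ℤ.- residue x n) (λ n → mod-neg (coherent x n))

  -- ℚₚ = ℤₚ[1/p]: X /p^ k stands for X/pᵏ.
  infix 8 _/p^_

  record ℚₚ : Set where
    constructor _/p^_
    field
      num : ℤₚ
      exp : ℕ

  open ℚₚ public

  infix  4 _≈_ _#0
  infixl 6 _+_ _-_
  infixl 7 _*_ _/_
  infixr 8 _^_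
  infix  8 -_

  -- Cross-multiplication suffices because p is not a zero divisor in ℤₚ.
  record _≈_ (x y : ℚₚ) : Set where
    constructor mk≈
    field cross : num x *ᶻ fromℤ (p^ exp y) ≈ᶻ num y *ᶻ fromℤ (p^ exp x)

  open _≈_ public

  ι : ℤₚ → ℚₚ
  ι X = X /p^ 0

  fromℕ : ℕ → ℚₚ
  fromℕ n = ι (fromℤ (+ n))

  1ℚₚ : ℚₚ
  1ℚₚ = fromℕ 1

  _+_ _*_ : ℚₚ → ℚₚ → ℚₚ
  (X /p^ k) + (Y /p^ l) = (X *ᶻ fromℤ (p^ l) +ᶻ Y *ᶻ fromℤ (p^ k)) /p^ (k ℕ.+ l)
  (X /p^ k) * (Y /p^ l) = (X *ᶻ Y) /p^ (k ℕ.+ l)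

  -_ : ℚₚ → ℚₚ
  - (X /p^ k) = (-ᶻ X) /p^ k

  _-_ : ℚₚ → ℚₚ → ℚₚ
  x - y = x + (- y)

  _^_ : ℚₚ → ℕ → ℚₚ
  x ^ zero  = 1ℚₚ
  x ^ suc n = x * x ^ n

  -- The positive form of x ≠ 0: some residue of the numerator is nonzero.
  -- It implies ¬ (x ≈ 0), and is equivalent to it classically.
  _#0 : ℚₚ → Set
  (X /p^ k) #0 = ∃[ n ] ¬ (residue X n ≡ + 0 mod-p^ n)

  module Inversion where
    p-nonZero : ℕ.NonZero p
    p-nonZero = prime⇒nonZero p-prime

    p^-nonZero : ∀ n → ℤ.NonZero (p^ n)
    p^-nonZero n = ℤ.≢-nonZero λ e →
      ℕ.≢-nonZero⁻¹ p {{p-nonZero}} (cong ℤ.∣_∣ (ℤ.i^n≡0⇒i≡0 (+ p) n e))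

    coprime : ∀ {m} → ¬ (p ℕ.∣ m) → Coprime m p
    coprime ¬p∣m (d∣m , d∣p) with prime⇒irreducible p-prime d∣p
    ... | inj₁ d≡1  = d≡1
    ... | inj₂ refl = ⊥-elim (¬p∣m d∣m)

    inverse-mod-p-ℕ : ∀ m → ¬ (p ℕ.∣ m) → ∃[ u ] + p ∣ + m ℤ.* u ℤ.- + 1
    inverse-mod-p-ℕ m ¬p∣m with coprime-Bézout (coprime ¬p∣m)
    ... | Bézout.+- a b eq = + a , divides (+ b)
          (trans (cong (λ t → t ℤ.- + 1) eq′) (lem (+ b ℤ.* + p)))
      where
      eq′ : + m ℤ.* + a ≡ + 1 ℤ.+ + b ℤ.* + p
      eq′ = trans (ℤ.*-comm (+ m) (+ a)) (trans (sym (ℤ.pos-* a m))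
            (trans (cong +_ (sym eq)) (cong (λ t → + 1 ℤ.+ t) (ℤ.pos-* b p))))
      lem : ∀ t → (+ 1 ℤ.+ t) ℤ.- + 1 ≡ t
      lem = solve-∀
    ... | Bézout.-+ a b eq = ℤ.- (+ a) , divides (ℤ.- (+ b))
          (trans (lem (+ m) (+ a)) (trans (cong ℤ.-_ eq′) (ℤ.neg-distribˡ-* (+ b) (+ p))))
      where
      eq′ : + 1 ℤ.+ + a ℤ.* + m ≡ + b ℤ.* + p
      eq′ = trans (cong (λ t → + 1 ℤ.+ t) (sym (ℤ.pos-* a m)))
            (trans (cong +_ eq) (ℤ.pos-* b p))
      lem : ∀ m a → m ℤ.* (ℤ.- a) ℤ.- + 1 ≡ ℤ.- (+ 1 ℤ.+ a ℤ.* m)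
      lem = solve-∀

    inverse-mod-p : ∀ x → ¬ (+ p ∣ x) → ∃[ u ] + p ∣ x ℤ.* u ℤ.- + 1
    inverse-mod-p (+ m) h = inverse-mod-p-ℕ m (λ d → h (∣ᵤ⇒∣ d))
    inverse-mod-p -[1+ m ] h with inverse-mod-p-ℕ (suc m) (λ d → h (∣ᵤ⇒∣ d))
    ... | u , d = ℤ.- u , by d (lem (+ suc m) u)
      where lem : ∀ a u → a ℤ.* u ℤ.- + 1 ≡ (ℤ.- a) ℤ.* (ℤ.- u) ℤ.- + 1
            lem = solve-∀

    inverse-mod-p^ : ∀ x → ¬ (+ p ∣ x) → ∀ M → ∃[ w ] x ℤ.* w ≡ + 1 mod-p^ M
    inverse-mod-p^ x h zero =
      + 0 , mod (divides (x ℤ.* + 0 ℤ.- + 1) (sym (ℤ.*-identityʳ (x ℤ.* + 0 ℤ.- + 1))))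
    inverse-mod-p^ x h (suc M) with inverse-mod-p x h | inverse-mod-p^ x h M
    ... | u , divides q e | w , mod (divides r f) =
          w ℤ.+ u ℤ.- x ℤ.* w ℤ.* u , mod (divides (ℤ.- (q ℤ.* r))
          (trans (lem x u w) (trans (cong₂ (λ s t → ℤ.- (s ℤ.* t)) e f) (lem′ q r (+ p) (p^ M)))))
      where
      lem : ∀ x u w → x ℤ.* (w ℤ.+ u ℤ.- x ℤ.* w ℤ.* u) ℤ.- + 1
                    ≡ ℤ.- ((x ℤ.* u ℤ.- + 1) ℤ.* (x ℤ.* w ℤ.- + 1))
      lem = solve-∀
      lem′ : ∀ q r a b → ℤ.- ((q ℤ.* a) ℤ.* (r ℤ.* b)) ≡ (ℤ.- (q ℤ.* r)) ℤ.* (a ℤ.* b)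
      lem′ = solve-∀

    cofactor : ∀ n x → ¬ (p^ n ∣ x) → ∀ M → ∃[ y ] x ℤ.* y ≡ p^ n mod-p^ M
    cofactor zero x h M = ⊥-elim (h (divides x (sym (ℤ.*-identityʳ x))))
    cofactor (suc n) x h M with + p ∣? x
    ... | yes (divides x′ refl)
          with y , mod d ← cofactor n x′
                 (λ d → h (by (*-monoʳ-∣ (+ p) d) (ℤ.*-comm (+ p) x′))) M
          = y , mod (by (∣n⇒∣m*n (+ p) d) (lem (+ p) x′ y (p^ n)))
      where lem : ∀ a x y b → a ℤ.* (x ℤ.* y ℤ.- b) ≡ x ℤ.* a ℤ.* y ℤ.- a ℤ.* b
            lem = solve-∀
    ... | no ¬p∣x with w , mod d ← inverse-mod-p^ x ¬p∣x M
          = w ℤ.* p^ suc n , mod (by (∣m⇒∣m*n (p^ suc n) d) (lem x w (p^ suc n)))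
      where lem : ∀ x w b → (x ℤ.* w ℤ.- + 1) ℤ.* b ≡ x ℤ.* (w ℤ.* b) ℤ.- b
            lem = solve-∀

    cancel : ∀ n j x d → ¬ (p^ n ∣ x) → p^ (j ℕ.+ n) ∣ x ℤ.* d → p^ j ∣ d
    cancel n j x d h k with y , mod e ← cofactor n x h (j ℕ.+ n) =
      *-cancelʳ-∣ (p^ n) {{p^-nonZero n}}
        (subst (_∣ d ℤ.* p^ n) (ℤ.^-distribˡ-+-* (+ p) j n)
          (by (∣m∣n⇒∣m-n (∣n⇒∣m*n y k) (∣n⇒∣m*n d e)) (lem x y d (p^ n))))
      where lem : ∀ x y d b → y ℤ.* (x ℤ.* d) ℤ.- d ℤ.* (x ℤ.* y ℤ.- b) ≡ d ℤ.* b
            lem = solve-∀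

    p^-weaken : ∀ i {n a b} → a ≡ b mod-p^ (i ℕ.+ n) → a ≡ b mod-p^ n
    p^-weaken zero    h = h
    p^-weaken (suc i) h = p^-weaken i (p^-step h)

    residue-mod : ∀ X i n → residue X (i ℕ.+ n) ≡ residue X n mod-p^ n
    residue-mod X zero    n = mod-refl
    residue-mod X (suc i) n =
      mod-trans (p^-weaken i (coherent X (i ℕ.+ n))) (residue-mod X i n)

    module Divide (X : ℤₚ) (n : ℕ) (h : ¬ (residue X n ≡ + 0 mod-p^ n)) where
      ¬p^n∣X : ∀ j → ¬ (p^ n ∣ residue X (j ℕ.+ n))
      ¬p^n∣X j d = h (mod-trans (mod-sym (residue-mod X j n))
                                (mod (by d (sym (ℤ.+-identityʳ (residue X (j ℕ.+ n)))))))

      q : ℕ → ℤ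
      q j = proj₁ (cofactor n (residue X (j ℕ.+ n)) (¬p^n∣X j) (j ℕ.+ n))

      q-spec : ∀ j → residue X (j ℕ.+ n) ℤ.* q j ≡ p^ n mod-p^ (j ℕ.+ n)
      q-spec j = proj₂ (cofactor n (residue X (j ℕ.+ n)) (¬p^n∣X j) (j ℕ.+ n))

      q-coherent : ∀ j → q (suc j) ≡ q j mod-p^ j
      q-coherent j = mod (cancel n j x (q (suc j) ℤ.- q j) (¬p^n∣X j)
        (by (p^n∣a-b xq′≡xq) (lem x (q (suc j)) (q j))))
        where
        x = residue X (j ℕ.+ n)
        xq′≡xq : x ℤ.* q (suc j) ≡ x ℤ.* q j mod-p^ (j ℕ.+ n)
        xq′≡xq = mod-trans (mod-* (mod-sym (coherent X (j ℕ.+ n))) mod-refl)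
          (mod-trans (p^-step (q-spec (suc j))) (mod-sym (q-spec j)))
        lem : ∀ x a b → x ℤ.* a ℤ.- x ℤ.* b ≡ x ℤ.* (a ℤ.- b)
        lem = solve-∀

  open Inversion

  -- If X ≢ 0 mod pⁿ then X divides pⁿ in ℤₚ; this is the quotient pⁿ/X.
  p^_÷_ : (n : ℕ) (X : ℤₚ) → ¬ (residue X n ≡ + 0 mod-p^ n) → ℤₚ
  (p^ n ÷ X) h = mkℤₚ (Divide.q X n h) (Divide.q-coherent X n h)

  _⁻¹ : (x : ℚₚ) → x #0 → ℚₚ
  ((X /p^ k) ⁻¹) (n , h) = (fromℤ (p^ k) *ᶻ (p^ n ÷ X) h) /p^ n

  ⁻¹-inverseʳ : ∀ x (x#0 : x #0) → x * (x ⁻¹) x#0 ≈ 1ℚₚ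
  ⁻¹-inverseʳ (X /p^ k) (n , h) = mk≈ (mk≈ᶻ λ j → mod
    (by (∣n⇒∣m*n (p^ k) (p^n∣a-b (Xq≡p^n j)))
       (trans (lem (p^ k) (residue X j) (q j) (p^ n))
              (cong (λ t → residue X j ℤ.* (p^ k ℤ.* q j) ℤ.* + 1 ℤ.- + 1 ℤ.* t)
                    (sym (ℤ.^-distribˡ-+-* (+ p) k n))))))
    where
    open Divide X n h
    Xq≡p^n : ∀ j → residue X j ℤ.* q j ≡ p^ n mod-p^ j
    Xq≡p^n j = mod-trans
      (mod-* (mod-sym (subst (λ m → residue X m ≡ residue X j mod-p^ j)
                             (ℕ.+-comm n j) (residue-mod X n j)))
             mod-refl)
      (p^-weaken n (subst (λ m → residue X (j ℕ.+ n) ℤ.* q j ≡ p^ n mod-p^ m)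
                          (ℕ.+-comm j n) (q-spec j)))
    lem : ∀ a x q b → a ℤ.* (x ℤ.* q ℤ.- b) ≡ x ℤ.* (a ℤ.* q) ℤ.* + 1 ℤ.- + 1 ℤ.* (a ℤ.* b)
    lem = solve-∀

  _/_ : ℚₚ → (y : ℚₚ) → {y #0} → ℚₚ
  (x / y) {y#0} = x * (y ⁻¹) y#0

  p^_∣ᶻ_ : ℤ → ℤₚ → Set
  p^ (+ n)    ∣ᶻ X = residue X n ≡ + 0 mod-p^ n
  p^ -[1+ _ ] ∣ᶻ X = ⊤

  -- |x|ₚ ≤ p⁻ⁱ, i.e. vₚ(x) ≥ i, where vₚ(X/pᵏ) = vₚ(X) - k and vₚ(X) ≥ n
  -- means that X vanishes modulo pⁿ.
  infix 4 ∣_∣≤p^-_ ∣_∣≤∣_∣ ∣_∣<∣_∣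

  ∣_∣≤p^-_ : ℚₚ → ℤ → Set
  ∣ X /p^ k ∣≤p^- i = p^ (i ℤ.+ + k) ∣ᶻ X

  -- |·|ₚ takes values in {0} ∪ {pⁱ : i ∈ ℤ}, so absolute values are compared
  -- through the powers of p which bound them. Deciding whether x is zero, and
  -- hence computing |x|ₚ as an element of that set, is not possible
  -- constructively.
  ∣_∣≤∣_∣ ∣_∣<∣_∣ : ℚₚ → ℚₚ → Set
  ∣ x ∣≤∣ y ∣ = ∀ i → ∣ y ∣≤p^- i → ∣ x ∣≤p^- i
  ∣ x ∣<∣ y ∣ = ∃[ i ] (∣ x ∣≤p^- i) × ¬ (∣ y ∣≤p^- i)

  <⇒#0 : ∀ {x y} → ∣ x ∣<∣ y ∣ → y #0
  <⇒#0 {y = Y /p^ k} (i , _ , h) with i ℤ.+ + k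
  ... | + n      = n , h
  ... | -[1+ _ ] = ⊥-elim (h tt)

  infixr 6 _+ₛ_
  infixr 7 _*ₛ_

  _+ₛ_ _*ₛ_ : ℚₚ → Pred ℚₚ 0ℓ → Pred ℚₚ 0ℓ
  (x +ₛ A) y = ∃[ a ] a ∈ A × y ≈ x + a
  (x *ₛ A) y = ∃[ a ] a ∈ A × y ≈ x * a

  𝐙ₚ : Pred ℚₚ 0ℓ
  𝐙ₚ x = ∃[ z ] x ≈ ι z

  closure : Pred ℚₚ 0ℓ → Pred ℚₚ 0ℓ
  closure A x = ∀ i → ∃[ a ] a ∈ A × ∣ x - a ∣≤p^- i

  ratios : (ℕ → ℚₚ) → Pred ℚₚ 0ℓ
  ratios a x = ∃[ n ] Σ[ aₙ#0 ∈ a n #0 ] x ≈ (a (suc n) / a n) {aₙ#0}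

  KeplerSet : (ℕ → ℚₚ) → Pred ℚₚ 0ℓ
  KeplerSet a = closure (ratios a)

{-# OPTIONS --safe #-}
module Submission where

-- Writing u = 1/(c₁ + c₂ n), consecutive ratios are a_{n+1}/a_n = λ(1 + c₂ u).
--
-- If |c₁| > |c₂| and r = c₂/c₁, this is λ(1 + r/(1 + r n)) = λ(1 + r + r² z) with
-- z = -n/(1 + r n), and z ↦ -z/(1 + r z) is a continuous involution of ℤₚ, so the values
-- z are dense in ℤₚ because ℕ is.
--
-- If |c₁| ≤ |c₂| and s = c₁/c₂ ∈ ℤₚ, it is λ(1 + 1/(s + n)). The numbers s + n are dense in
-- ℤₚ, and inversion maps ℤₚ ∖ {0} onto ℚₚ ∖ pℤₚ, which is closed.

open import Defs
open import Algebra.Bundles using (CommutativeRing)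
import Algebra.Solver.Ring
open import Algebra.Solver.Ring.AlmostCommutativeRing using (_-Raw-AlmostCommutative⟶_; fromCommutativeRing)
open import Algebra.Structures using (IsAbelianGroup)
open import Data.Empty using (⊥-elim)
open import Data.Integer.Base as ℤ using (ℤ; +_; -[1+_])
open import Data.Integer.Divisibility.Signed
open import Data.Integer.DivMod using (_%ℕ_; _/ℕ_; a≡a%ℕn+[a/ℕn]*n)
import Data.Integer.Properties as ℤ
open import Data.Integer.Tactic.RingSolver using (solve-∀)
open import Data.Maybe.Base using (Maybe; just; nothing)
open import Data.Nat.Base as ℕ using (ℕ; zero; suc)
import Data.Nat.Divisibility as ℕ
open import Data.Nat.Primality using (Prime; ¬prime[1])
import Data.Nat.Properties as ℕ
open import Data.Product.Base using (∃-syntax; _×_; _,_; proj₁; proj₂)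
open import Data.Unit.Base using (tt)
open import Level using (0ℓ)
open import Relation.Binary.Bundles using (Setoid)
import Relation.Binary.PropositionalEquality as ≡
open ≡ using (_≡_)
open import Relation.Nullary using (¬_; Dec; yes; no)
open import Relation.Unary using (Pred; _∈_; _⊆_; _≐_; ∁)

-- Whether a p-adic number is zero cannot be decided, so the argument uses only the predicates
-- `V i`; a refutation of `V i x` is strong enough to yield an inverse of x together with a bound on
-- it. Likewise the n with c₁ + c₂ n = 0 cannot be singled out, so each ratio carries its u as a
-- witness, and density has to supply it. When |c₁| > |c₂| every 1 + r n is a unit; in the other
-- case n is taken so close to its target that s + n becomes a unit multiple of a number already
-- known to be invertible. Closedness needs a single approximant: lying in the disc, or in 1 + pℤₚ
-- after division by λ, is one condition `V (+ 0)` or `V (+ 1)`, which a small enough error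
-- preserves. The involution arises by solving z = -n/(1 + r n) for n, since z + n + r n z = 0 is
-- symmetric in n and z.

record IntegerAlgebra : Set₁ where
  field
    commutativeRing : CommutativeRing 0ℓ 0ℓ
    fromℤ-homomorphism : ℤ.+-*-rawRing -Raw-AlmostCommutative⟶ fromCommutativeRing commutativeRing

  open CommutativeRing commutativeRing public
  open _-Raw-AlmostCommutative⟶_ fromℤ-homomorphism public using (⟦_⟧) renaming (+-homo to ⟦⟧-+)

  ⟦⟧-≟ : ∀ a b → Maybe (⟦ a ⟧ ≈ ⟦ b ⟧)
  ⟦⟧-≟ a b with a ℤ.≟ b
  ... | yes ≡.refl = just refl
  ... | no _       = nothing

  open Algebra.Solver.Ring ℤ.+-*-rawRing (fromCommutativeRing commutativeRing)
    fromℤ-homomorphism ⟦⟧-≟ public using (solve; con; _:+_; _:*_; _:-_; :-_; _:=_)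

  open import Relation.Binary.Reasoning.Setoid setoid public

  -- An equation X ≈ Y that follows from hypotheses lₖ ≈ rₖ is proved by solving
  -- X ≈ Y + Σ cₖ (lₖ - rₖ) with explicit cofactors cₖ and dropping the sum.
  drop : ∀ {l r} c y → l ≈ r → y + c * (l - r) ≈ y
  drop {l} {r} c y l≈r = begin
    y + c * (l - r) ≈⟨ +-congˡ (*-congˡ (+-congʳ l≈r)) ⟩
    y + c * (r - r) ≈⟨ solve 3 (λ y c r → y :+ c :* (r :- r) := y) refl y c r ⟩
    y               ∎

  inverse-unique : ∀ {x y z} → x * y ≈ ⟦ + 1 ⟧ → x * z ≈ ⟦ + 1 ⟧ → y ≈ z
  inverse-unique {x} {y} {z} xy≈1 xz≈1 = trans
    (solve 3 (λ x y z → y := z :+ z :* (x :* y :- con (+ 1)) :+ (:- y) :* (x :* z :- con (+ 1)))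
      refl x y z)
    (trans (drop _ _ xz≈1) (drop _ _ xy≈1))

-- Valued fields in which ℕ is dense in the integers

-- V i x stands for v(x) ≥ i. The index 1 - i in inverse expresses that v(x) ≤ i - 1.
record ValuedField : Set₁ where
  field integerAlgebra : IntegerAlgebra
  open IntegerAlgebra integerAlgebra public
  field
    V         : ℤ → Carrier → Set
    V-resp    : ∀ {i x y} → x ≈ y → V i x → V i y
    V-anti    : ∀ {i j x} → j ℤ.≤ i → V i x → V j x
    V-+       : ∀ {i x y} → V i x → V i y → V i (x + y)
    V-*       : ∀ {i j x y} → V i x → V j y → V (i ℤ.+ j) (x * y)
    V-ℤ       : ∀ a → V (+ 0) ⟦ a ⟧
    V-bounded : ∀ x → ∃[ i ] V i x
    1∉V₁      : ¬ V (+ 1) ⟦ + 1 ⟧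
    inverse   : ∀ {i x} → ¬ V i x → ∃[ y ] x * y ≈ ⟦ + 1 ⟧ × V (+ 1 ℤ.- i) y
    ℕ-dense   : ∀ {x} → V (+ 0) x → ∀ i → ∃[ n ] V i (x - ⟦ + n ⟧)

  V-*ˡ : ∀ {i c x} → V (+ 0) c → V i x → V i (c * x)
  V-*ˡ {i} hc hx = ≡.subst (λ j → V j _) (ℤ.+-identityˡ i) (V-* hc hx)

  V-neg : ∀ {i x} → V i x → V i (- x)
  V-neg {x = x} h = V-resp (solve 1 (λ x → con (ℤ.- + 1) :* x := :- x) refl x) (V-*ˡ (V-ℤ (ℤ.- + 1)) h)

  V-- : ∀ {i x y} → V i x → V i y → V i (x - y)
  V-- hx hy = V-+ hx (V-neg hy)

  -- A lower bound k for v(c) is enough, and `V-bounded` gives one even when v(c) itself is unknown.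
  *-continuous : ∀ c i → ∃[ j ] (∀ {e} → V j e → V i (c * e))
  *-continuous c i with k , hc ← V-bounded c =
    i ℤ.- k , λ he → ≡.subst (λ j → V j _) (lem k i) (V-* hc he)
    where
    lem : ∀ k i → k ℤ.+ (i ℤ.- k) ≡ i
    lem = solve-∀

  -- If 1 + t had positive valuation, so would 1 = (1 + t) - t. The index 1 - 1 returned by
  -- `inverse` makes the inverse integral.
  1+V₁-unit : ∀ {t} → V (+ 1) t → ∃[ w ] (⟦ + 1 ⟧ + t) * w ≈ ⟦ + 1 ⟧ × V (+ 0) w
  1+V₁-unit {t} ht = inverse λ h →
    1∉V₁ (V-resp (solve 1 (λ t → con (+ 1) :+ t :- t := con (+ 1)) refl t) (V-- h ht))

  1+V₁-inverse : ∀ {t w} → V (+ 1) t → (⟦ + 1 ⟧ + t) * w ≈ ⟦ + 1 ⟧ → V (+ 0) w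
  1+V₁-inverse ht hw with w′ , hw′ , w′∈V₀ ← 1+V₁-unit ht =
    V-resp (inverse-unique hw′ hw) w′∈V₀

  -- The index i separates c from d: the inverse of c has index 1 - i, and r is d times this
  -- inverse.
  quotient∈V₁ : ∀ {i c d r} → ¬ V i c → V i d → c * r ≈ d → V (+ 1) r
  quotient∈V₁ {i} {c} {d} {r} hc hd cr≈d with y , cy≈1 , hy ← inverse hc =
    V-resp
      (trans (solve 4 (λ c d r y → d :* y :=
          r :+ r :* (c :* y :- con (+ 1)) :+ (:- y) :* (c :* r :- d)) refl c d r y)
        (trans (drop _ _ cr≈d) (drop _ _ cy≈1)))
      (≡.subst (λ j → V j (d * y)) (lem i) (V-* hd hy))
    where
    lem : ∀ i → i ℤ.+ (+ 1 ℤ.- i) ≡ + 1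
    lem = solve-∀

  Closure : Pred Carrier 0ℓ → Pred Carrier 0ℓ
  Closure A x = ∀ i → ∃[ a ] A a × V i (x - a)

  closure-mono : ∀ {A B : Pred Carrier 0ℓ} → A ⊆ B → Closure A ⊆ Closure B
  closure-mono A⊆B hx i with a , ha , hxa ← hx i = a , A⊆B ha , hxa

  -- Consecutive ratios in closed form

  module Ratios (c₁ c₂ lam lam⁻¹ : Carrier) (lam-inverse : lam * lam⁻¹ ≈ ⟦ + 1 ⟧) where

    -- The power λⁿ is always invertible and cancels from the quotient, so only an inverse of c₁ +
    -- c₂ n is recorded.
    Ratio : Pred Carrier 0ℓ
    Ratio q = ∃[ n ] ∃[ u ] (c₁ + c₂ * ⟦ + n ⟧) * u ≈ ⟦ + 1 ⟧ × q ≈ lam * (⟦ + 1 ⟧ + c₂ * u)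

    -- Here `L` plays the role of λⁿ and `I` that of 1/aₙ, so `L * I` is the inverse u of c₁ + c₂ n.
    quotient≈ : ∀ n {L I} → (c₁ + c₂ * ⟦ + n ⟧) * L * I ≈ ⟦ + 1 ⟧ →
      (c₁ + c₂ * ⟦ + suc n ⟧) * (lam * L) * I ≈ lam * (⟦ + 1 ⟧ + c₂ * (L * I))
    quotient≈ n {L} {I} h = begin
      (c₁ + c₂ * ⟦ + suc n ⟧) * (lam * L) * I
        ≈⟨ *-congʳ (*-congʳ (+-congˡ (*-congˡ (⟦⟧-+ (+ 1) (+ n))))) ⟩
      (c₁ + c₂ * (⟦ + 1 ⟧ + ⟦ + n ⟧)) * (lam * L) * I
        ≈⟨ solve 6 (λ c₁ c₂ l ν L I →
             (c₁ :+ c₂ :* (con (+ 1) :+ ν)) :* (l :* L) :* I :=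
             l :* (con (+ 1) :+ c₂ :* (L :* I)) :+ l :* ((c₁ :+ c₂ :* ν) :* L :* I :- con (+ 1)))
             refl c₁ c₂ lam ⟦ + n ⟧ L I ⟩
      _ ≈⟨ drop _ _ h ⟩
      lam * (⟦ + 1 ⟧ + c₂ * (L * I)) ∎

    quotient⇒Ratio : ∀ n {L I q} → (c₁ + c₂ * ⟦ + n ⟧) * L * I ≈ ⟦ + 1 ⟧ →
      q ≈ (c₁ + c₂ * ⟦ + suc n ⟧) * (lam * L) * I → Ratio q
    quotient⇒Ratio n {L} {I} h hq =
      n , L * I , trans (sym (*-assoc _ _ _)) h , trans hq (quotient≈ n h)

    Ratio⇒quotient : ∀ n {L I u q} → (c₁ + c₂ * ⟦ + n ⟧) * L * I ≈ ⟦ + 1 ⟧ →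
      (c₁ + c₂ * ⟦ + n ⟧) * u ≈ ⟦ + 1 ⟧ → q ≈ lam * (⟦ + 1 ⟧ + c₂ * u) →
      q ≈ (c₁ + c₂ * ⟦ + suc n ⟧) * (lam * L) * I
    Ratio⇒quotient n h hu hq = trans hq (trans
      (*-congˡ (+-congˡ (*-congˡ (inverse-unique hu (trans (sym (*-assoc _ _ _)) h)))))
      (sym (quotient≈ n h)))

    -- The case |c₁| > |c₂|: a disc

    module Dominant (r c₁⁻¹ c₂⁻¹ : Carrier) (c₁r≈c₂ : c₁ * r ≈ c₂)
                    (c₁-inverse : c₁ * c₁⁻¹ ≈ ⟦ + 1 ⟧) (c₂-inverse : c₂ * c₂⁻¹ ≈ ⟦ + 1 ⟧)
                    (r∈V₁ : V (+ 1) r) where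

      -- Substituting w = c₁ u leaves a dependence on r alone.
      Ratioʳ : Pred Carrier 0ℓ
      Ratioʳ q = ∃[ n ] ∃[ w ] (⟦ + 1 ⟧ + r * ⟦ + n ⟧) * w ≈ ⟦ + 1 ⟧ × q ≈ lam * (⟦ + 1 ⟧ + r * w)

      Ratio⊆Ratioʳ : Ratio ⊆ Ratioʳ
      Ratio⊆Ratioʳ (n , u , hu , hq) = n , c₁ * u ,
        trans (solve 5 (λ c₁ c₂ r u ν →
            (con (+ 1) :+ r :* ν) :* (c₁ :* u) :=
            con (+ 1) :+ con (+ 1) :* ((c₁ :+ c₂ :* ν) :* u :- con (+ 1))
              :+ ν :* u :* (c₁ :* r :- c₂)) refl c₁ c₂ r u ⟦ + n ⟧)
          (trans (drop _ _ c₁r≈c₂) (drop _ _ hu)) ,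
        trans hq (sym (trans (solve 5 (λ c₁ c₂ r u l →
            l :* (con (+ 1) :+ r :* (c₁ :* u)) :=
            l :* (con (+ 1) :+ c₂ :* u) :+ l :* u :* (c₁ :* r :- c₂))
            refl c₁ c₂ r u lam)
          (drop _ _ c₁r≈c₂)))

      Ratioʳ⊆Ratio : Ratioʳ ⊆ Ratio
      Ratioʳ⊆Ratio (n , w , hw , hq) = n , c₁⁻¹ * w ,
        trans (solve 6 (λ c₁ c₂ r d w ν →
            (c₁ :+ c₂ :* ν) :* (d :* w) :=
            con (+ 1) :+ con (+ 1) :* ((con (+ 1) :+ r :* ν) :* w :- con (+ 1))
              :+ (con (+ 1) :+ r :* ν) :* w :* (c₁ :* d :- con (+ 1))
              :+ (:- (ν :* d :* w)) :* (c₁ :* r :- c₂)) refl c₁ c₂ r c₁⁻¹ w ⟦ + n ⟧)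
          (trans (drop _ _ c₁r≈c₂) (trans (drop _ _ c₁-inverse) (drop _ _ hw))) ,
        trans hq (sym (trans (solve 6 (λ c₁ c₂ r d w l →
            l :* (con (+ 1) :+ c₂ :* (d :* w)) :=
            l :* (con (+ 1) :+ r :* w) :+ l :* r :* w :* (c₁ :* d :- con (+ 1))
              :+ (:- (l :* d :* w)) :* (c₁ :* r :- c₂)) refl c₁ c₂ r c₁⁻¹ w lam)
          (trans (drop _ _ c₁r≈c₂) (drop _ _ c₁-inverse))))

      r⁻¹ : Carrier
      r⁻¹ = c₁ * c₂⁻¹

      r-inverse : r * r⁻¹ ≈ ⟦ + 1 ⟧
      r-inverse = begin
        r * (c₁ * c₂⁻¹) ≈⟨ solve 3 (λ r c e → r :* (c :* e) := c :* r :* e) refl r c₁ c₂⁻¹ ⟩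
        c₁ * r * c₂⁻¹   ≈⟨ *-congʳ c₁r≈c₂ ⟩
        c₂ * c₂⁻¹       ≈⟨ c₂-inverse ⟩
        ⟦ + 1 ⟧         ∎

      -- The coordinate of x in the disc must be z = r⁻²(λ⁻¹ x - 1 - r). The ratio at n has the
      -- integral coordinate -n w, and the two coordinates differ by r⁻² λ⁻¹ (x - a), so it suffices
      -- that this error be integral; hence the target index 0 for `j`.
      closure-Ratioʳ⇒disc : ∀ {x} → Closure Ratioʳ x →
        ∃[ z ] V (+ 0) z × x ≈ lam * (⟦ + 1 ⟧ + r + r * r * z)
      closure-Ratioʳ⇒disc {x} hx
        with j , hj ← *-continuous (r⁻¹ * r⁻¹ * lam⁻¹) (+ 0)
        with a , ha , hxa ← hx j
        with n , w , hw , hq ← ha =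
        r⁻¹ * r⁻¹ * y , V-resp z-eq z∈V₀ , sym x-eq
        where
        ν y : Carrier
        ν = ⟦ + n ⟧
        y = lam⁻¹ * x - (⟦ + 1 ⟧ + r)

        z∈V₀ : V (+ 0) (r⁻¹ * r⁻¹ * (lam⁻¹ * (x - a)) - ν * w)
        z∈V₀ = V-- (V-resp (*-assoc _ _ _) (hj hxa))
          (V-*ˡ (V-ℤ (+ n)) (1+V₁-inverse (V-* r∈V₁ (V-ℤ (+ n))) hw))

        z-eq : r⁻¹ * r⁻¹ * (lam⁻¹ * (x - a)) - ν * w ≈ r⁻¹ * r⁻¹ * y
        z-eq = begin
          r⁻¹ * r⁻¹ * (lam⁻¹ * (x - a)) - ν * w
            ≈⟨ +-congʳ (*-congˡ (*-congˡ (+-congˡ (-‿cong hq)))) ⟩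
          r⁻¹ * r⁻¹ * (lam⁻¹ * (x - lam * (⟦ + 1 ⟧ + r * w))) - ν * w
            ≈⟨ +-congʳ (*-congˡ (trans
                 (solve 4 (λ l m x b → m :* (x :- l :* b)
                   := m :* x :- b :+ (:- b) :* (l :* m :- con (+ 1)))
                   refl lam lam⁻¹ x (⟦ + 1 ⟧ + r * w))
                 (drop _ _ lam-inverse))) ⟩
          r⁻¹ * r⁻¹ * (lam⁻¹ * x - (⟦ + 1 ⟧ + r * w)) - ν * w
            ≈⟨ solve 5 (λ g r s w ν →
                 s :* s :* (g :- (con (+ 1) :+ r :* w)) :- ν :* w :=
                 s :* s :* (g :- (con (+ 1) :+ r))
                   :+ (:- s) :* ((con (+ 1) :+ r :* ν) :* w :- con (+ 1))
                   :+ (ν :* w :- s :* (w :- con (+ 1))) :* (r :* s :- con (+ 1)))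
                 refl (lam⁻¹ * x) r r⁻¹ w ν ⟩
          _ ≈⟨ drop _ _ r-inverse ⟩
          _ ≈⟨ drop _ _ hw ⟩
          r⁻¹ * r⁻¹ * y ∎

        x-eq : lam * (⟦ + 1 ⟧ + r + r * r * (r⁻¹ * r⁻¹ * y)) ≈ x
        x-eq = begin
          lam * (⟦ + 1 ⟧ + r + r * r * (r⁻¹ * r⁻¹ * y))
            ≈⟨ *-congˡ (+-congˡ (trans
                 (solve 3 (λ r s y → r :* r :* (s :* s :* y) :=
                   y :+ (r :* s :+ con (+ 1)) :* y :* (r :* s :- con (+ 1))) refl r r⁻¹ y)
                 (drop _ _ r-inverse))) ⟩
          lam * (⟦ + 1 ⟧ + r + y)
            ≈⟨ solve 4 (λ l m x r →
                 l :* (con (+ 1) :+ r :+ (m :* x :- (con (+ 1) :+ r))) :=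
                 x :+ x :* (l :* m :- con (+ 1))) refl lam lam⁻¹ x r ⟩
          _ ≈⟨ drop _ _ lam-inverse ⟩
          x ∎

      closure⇒disc : ∀ {x} → Closure Ratio x →
        ∃[ z ] V (+ 0) z × x ≈ lam * (⟦ + 1 ⟧ + r + r * r * z)
      closure⇒disc h = closure-Ratioʳ⇒disc (closure-mono {Ratio} {Ratioʳ} Ratio⊆Ratioʳ h)

      -- n ↦ -n/(1 + rn) and z ↦ -z/(1 + rz) are mutually inverse on ℤₚ.
      disc⇒closure : ∀ {x z} → V (+ 0) z → x ≈ lam * (⟦ + 1 ⟧ + r + r * r * z) →
        Closure Ratio x
      disc⇒closure {x} {z} hz hx i
        with v , hv , v∈V₀ ← 1+V₁-unit (V-* r∈V₁ hz)
        with j , hj ← *-continuous (lam * (r * r)) i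
        with n , hn ← ℕ-dense (V-neg (V-*ˡ hz v∈V₀)) j
        with w , hw , w∈V₀ ← 1+V₁-unit (V-* r∈V₁ (V-ℤ (+ n))) =
        lam * (⟦ + 1 ⟧ + r * w) , Ratioʳ⊆Ratio (n , w , hw , refl) ,
        -- The coordinates of x and of the ratio differ by z + n w = w (1 + r z)(n + z v). As w and
        -- 1 + r z are integral, the involution does not increase distances.
        V-resp (sym x-eq) (hj (V-*ˡ w∈V₀
          (V-*ˡ (V-+ (V-ℤ (+ 1)) (V-anti (ℤ.+≤+ ℕ.z≤n) (V-* r∈V₁ hz))) (V-neg hn))))
        where
        ν : Carrier
        ν = ⟦ + n ⟧

        x-eq : x - lam * (⟦ + 1 ⟧ + r * w) ≈
          lam * (r * r) * (w * ((⟦ + 1 ⟧ + r * z) * - (- (z * v) - ν)))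
        x-eq = begin
          x - lam * (⟦ + 1 ⟧ + r * w)
            ≈⟨ +-congʳ hx ⟩
          lam * (⟦ + 1 ⟧ + r + r * r * z) - lam * (⟦ + 1 ⟧ + r * w)
            ≈⟨ solve 5 (λ l r z w ν →
                 l :* (con (+ 1) :+ r :+ r :* r :* z) :- l :* (con (+ 1) :+ r :* w) :=
                 l :* (r :* r) :* (z :+ ν :* w)
                   :+ (:- (l :* r)) :* ((con (+ 1) :+ r :* ν) :* w :- con (+ 1)))
                 refl lam r z w ν ⟩
          _ ≈⟨ drop _ _ hw ⟩
          lam * (r * r) * (z + ν * w)
            ≈⟨ *-congˡ (trans (solve 5 (λ r z w ν v → z :+ ν :* w :=
                 w :* ((con (+ 1) :+ r :* z) :* (:- (:- (z :* v) :- ν)))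
                   :+ (:- z) :* ((con (+ 1) :+ r :* ν) :* w :- con (+ 1))
                   :+ (:- (w :* z)) :* ((con (+ 1) :+ r :* z) :* v :- con (+ 1)))
                 refl r z w ν v)
               (trans (drop _ _ hv) (drop _ _ hw))) ⟩
          lam * (r * r) * (w * ((⟦ + 1 ⟧ + r * z) * - (- (z * v) - ν))) ∎

    -- The case |c₁| ≤ |c₂|: the complement of a disc

    module Subordinate (c₂⁻¹ : Carrier) (c₂-inverse : c₂ * c₂⁻¹ ≈ ⟦ + 1 ⟧)
                       (s∈V₀ : V (+ 0) (c₁ * c₂⁻¹)) where
      s : Carrier
      s = c₁ * c₂⁻¹

      Ratioˢ : Pred Carrier 0ℓ
      Ratioˢ q = ∃[ n ] ∃[ w ] (s + ⟦ + n ⟧) * w ≈ ⟦ + 1 ⟧ × q ≈ lam * (⟦ + 1 ⟧ + w)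

      Ratio⊆Ratioˢ : Ratio ⊆ Ratioˢ
      Ratio⊆Ratioˢ (n , u , hu , hq) = n , c₂ * u ,
        trans (solve 5 (λ c₁ c₂ e u ν →
            (c₁ :* e :+ ν) :* (c₂ :* u) :=
            con (+ 1) :+ con (+ 1) :* ((c₁ :+ c₂ :* ν) :* u :- con (+ 1))
              :+ c₁ :* u :* (c₂ :* e :- con (+ 1))) refl c₁ c₂ c₂⁻¹ u ⟦ + n ⟧)
          (trans (drop _ _ c₂-inverse) (drop _ _ hu)) ,
        hq

      Ratioˢ⊆Ratio : Ratioˢ ⊆ Ratio
      Ratioˢ⊆Ratio (n , w , hw , hq) = n , c₂⁻¹ * w ,
        trans (solve 5 (λ c₁ c₂ e w ν →
            (c₁ :+ c₂ :* ν) :* (e :* w) :=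
            con (+ 1) :+ con (+ 1) :* ((c₁ :* e :+ ν) :* w :- con (+ 1))
              :+ ν :* w :* (c₂ :* e :- con (+ 1))) refl c₁ c₂ c₂⁻¹ w ⟦ + n ⟧)
          (trans (drop _ _ c₂-inverse) (drop _ _ hw)) ,
        trans hq (sym (trans (solve 4 (λ c₂ e w l →
            l :* (con (+ 1) :+ c₂ :* (e :* w)) :=
            l :* (con (+ 1) :+ w) :+ l :* w :* (c₂ :* e :- con (+ 1))) refl c₂ c₂⁻¹ w lam)
          (drop _ _ c₂-inverse)))

      -- The inverse w of the integral number s + n cannot have positive valuation. With x = λ(1 +
      -- t), an approximant a for which λ⁻¹(x - a) has positive valuation would force exactly that
      -- on w = t - λ⁻¹(x - a).
      closure-Ratioˢ⇒∉disc : ∀ {x t} → Closure Ratioˢ x → V (+ 1) t → ¬ (x ≈ lam * (⟦ + 1 ⟧ + t))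
      closure-Ratioˢ⇒∉disc {x} {t} hx ht x≈
        with j , hj ← *-continuous lam⁻¹ (+ 1)
        with a , ha , hxa ← hx j
        with n , w , hw , hq ← ha =
        1∉V₁ (V-resp hw (V-*ˡ (V-+ s∈V₀ (V-ℤ (+ n))) (V-resp w-eq (V-- ht (hj hxa)))))
        where
        w-eq : t - lam⁻¹ * (x - a) ≈ w
        w-eq = begin
          t - lam⁻¹ * (x - a)
            ≈⟨ +-congˡ (-‿cong (*-congˡ (+-cong x≈ (-‿cong hq)))) ⟩
          t - lam⁻¹ * (lam * (⟦ + 1 ⟧ + t) - lam * (⟦ + 1 ⟧ + w))
            ≈⟨ solve 4 (λ l m t w →
                 t :- m :* (l :* (con (+ 1) :+ t) :- l :* (con (+ 1) :+ w)) :=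
                 w :+ (w :- t) :* (l :* m :- con (+ 1))) refl lam lam⁻¹ t w ⟩
          _ ≈⟨ drop _ _ lam-inverse ⟩
          w ∎

      closure⇒∉disc : ∀ {x t} → Closure Ratio x → V (+ 1) t → ¬ (x ≈ lam * (⟦ + 1 ⟧ + t))
      closure⇒∉disc h = closure-Ratioˢ⇒∉disc (closure-mono {Ratio} {Ratioˢ} Ratio⊆Ratioˢ h)

      -- The inverse t of y is integral, so some n is close to t - s. With e = t - s - n one has s +
      -- n = t (1 - y e), whose inverse is y w for w = 1/(1 - y e), and y - y w = -y² w e.
      ∉V₁⇒closure : ∀ {x y} → ¬ V (+ 1) y → x ≈ lam * (⟦ + 1 ⟧ + y) → Closure Ratio x
      ∉V₁⇒closure {x} {y} y∉V₁ x≈ i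
        with t , yt≈1 , t∈V₀ ← inverse y∉V₁
        with j , hj ← *-continuous (lam * (y * y)) i
        with k , hk ← *-continuous y (+ 1)
        -- Precision `k` makes 1 - y e a unit, so that the ratio at n exists; precision `j` brings
        -- it close to x.
        with n , hn ← ℕ-dense (V-- t∈V₀ s∈V₀) (j ℤ.⊔ k)
        with w , hw , w∈V₀ ← 1+V₁-unit (V-neg (hk (V-anti (ℤ.i≤j⊔i j k) hn))) =
        lam * (⟦ + 1 ⟧ + y * w) , Ratioˢ⊆Ratio (n , y * w , yw-inverse , refl) ,
        V-resp (sym x-eq) (hj (V-*ˡ w∈V₀ (V-neg (V-anti (ℤ.i≤i⊔j j k) hn))))
        where
        ν : Carrier
        ν = ⟦ + n ⟧

        yw-inverse : (s + ν) * (y * w) ≈ ⟦ + 1 ⟧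
        yw-inverse = trans
          (solve 5 (λ s t y w ν → (s :+ ν) :* (y :* w) :=
            con (+ 1) :+ con (+ 1) :* ((con (+ 1) :+ :- (y :* (t :- s :- ν))) :* w :- con (+ 1))
              :+ w :* (y :* t :- con (+ 1))) refl s t y w ν)
          (trans (drop _ _ yt≈1) (drop _ _ hw))

        x-eq : x - lam * (⟦ + 1 ⟧ + y * w) ≈ lam * (y * y) * (w * - (t - s - ν))
        x-eq = begin
          x - lam * (⟦ + 1 ⟧ + y * w)
            ≈⟨ +-congʳ x≈ ⟩
          lam * (⟦ + 1 ⟧ + y) - lam * (⟦ + 1 ⟧ + y * w)
            ≈⟨ solve 4 (λ l y w e →
                 l :* (con (+ 1) :+ y) :- l :* (con (+ 1) :+ y :* w) :=
                 l :* (y :* y) :* (w :* :- e)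
                   :+ (:- (l :* y)) :* ((con (+ 1) :+ :- (y :* e)) :* w :- con (+ 1)))
                 refl lam y w (t - s - ν) ⟩
          _ ≈⟨ drop _ _ hw ⟩
          lam * (y * y) * (w * - (t - s - ν)) ∎

      -- With y = λ⁻¹ x - 1, lying outside the disc refutes `V (+ 1) y`, which is the form `inverse`
      -- asks for; no excluded middle enters.
      ∉disc⇒closure : ∀ {x} → (∀ {t} → V (+ 1) t → ¬ (x ≈ lam * (⟦ + 1 ⟧ + t))) →
        Closure Ratio x
      ∉disc⇒closure {x} x∉ = ∉V₁⇒closure (λ y∈V₁ → x∉ y∈V₁ x≈) x≈
        where
        x≈ : x ≈ lam * (⟦ + 1 ⟧ + (lam⁻¹ * x - ⟦ + 1 ⟧))
        x≈ = sym (trans (solve 3 (λ l m x →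
            l :* (con (+ 1) :+ (m :* x :- con (+ 1))) := x :+ x :* (l :* m :- con (+ 1)))
            refl lam lam⁻¹ x)
          (drop _ _ lam-inverse))

-- The commutative ring ℚₚ

module Field (p : ℕ) (p-prime : Prime p) where
  open PAdic p p-prime
  open Congruence
  open Inversion
  open ≡ using (refl; sym; trans; cong; cong₂; subst)

  p^-+ : ∀ k l → p^ (k ℕ.+ l) ≡ p^ k ℤ.* p^ l
  p^-+ = ℤ.^-distribˡ-+-* (+ p)

  mod-reflexive : ∀ {n a b} → a ≡ b → a ≡ b mod-p^ n
  mod-reflexive refl = mod-refl

  cancel-p^ : ∀ l {n a b} → p^ l ℤ.* a ≡ p^ l ℤ.* b mod-p^ (l ℕ.+ n) → a ≡ b mod-p^ n
  cancel-p^ l {n} {a} {b} (mod h) = mod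
    (*-cancelˡ-∣ (p^ l) {{p^-nonZero l}}
      (subst (_∣ p^ l ℤ.* (a ℤ.- b)) (p^-+ l n) (by h (lem (p^ l) a b))))
    where
    lem : ∀ c a b → c ℤ.* a ℤ.- c ℤ.* b ≡ c ℤ.* (a ℤ.- b)
    lem = solve-∀

  -- Cancelling pˡ costs l levels of precision, so the hypothesis is used at level l + n and
  -- coherence leads back to level n.
  cancel-p^ᶻ : ∀ l {X Y} → fromℤ (p^ l) *ᶻ X ≈ᶻ fromℤ (p^ l) *ᶻ Y → X ≈ᶻ Y
  cancel-p^ᶻ l {X} {Y} (mk≈ᶻ h) = mk≈ᶻ λ n →
    mod-trans (mod-sym (residue-mod X l n))
      (mod-trans (cancel-p^ l (h (l ℕ.+ n))) (residue-mod Y l n))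

  pointwise : ∀ {x y} →
    (∀ n → residue (num x) n ℤ.* p^ exp y ≡ residue (num y) n ℤ.* p^ exp x) → x ≈ y
  pointwise h = mk≈ (mk≈ᶻ λ n → mod-reflexive (h n))

  ≈-refl : ∀ {x} → x ≈ x
  ≈-refl = pointwise λ _ → refl

  ≈-sym : ∀ {x y} → x ≈ y → y ≈ x
  ≈-sym (mk≈ (mk≈ᶻ h)) = mk≈ (mk≈ᶻ λ n → mod-sym (h n))

  -- Eliminating Y from the two cross-multiplied equations leaves the wanted one times the middle
  -- denominator pˡ, which is then cancelled.
  ≈-trans : ∀ {x y z} → x ≈ y → y ≈ z → x ≈ z
  ≈-trans {X /p^ k} {Y /p^ l} {Z /p^ m} (mk≈ (mk≈ᶻ h)) (mk≈ (mk≈ᶻ g)) =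
    mk≈ (cancel-p^ᶻ l (mk≈ᶻ λ n →
      mod-trans (mod-reflexive (lem₁ (p^ l) (residue X n) (p^ m)))
      (mod-trans (mod-* (h n) mod-refl)
      (mod-trans (mod-reflexive (lem₂ (residue Y n) (p^ k) (p^ m)))
      (mod-trans (mod-* (g n) mod-refl)
      (mod-reflexive (lem₃ (residue Z n) (p^ l) (p^ k))))))))
    where
    lem₁ : ∀ a x b → a ℤ.* (x ℤ.* b) ≡ x ℤ.* a ℤ.* b
    lem₁ = solve-∀
    lem₂ : ∀ y a b → y ℤ.* a ℤ.* b ≡ y ℤ.* b ℤ.* a
    lem₂ = solve-∀
    lem₃ : ∀ z a b → z ℤ.* a ℤ.* b ≡ a ℤ.* (z ℤ.* b)
    lem₃ = solve-∀

  -- Matches two forms of a number without comparing their coherence proofs.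
  residuewise : ∀ {x y} → (∀ n → residue (num x) n ≡ residue (num y) n) → exp x ≡ exp y → x ≈ y
  residuewise e e′ = pointwise λ n → cong₂ (λ s t → s ℤ.* p^ t) (e n) (sym e′)

  ℚₚ-setoid : Setoid 0ℓ 0ℓ
  ℚₚ-setoid = record
    { Carrier = ℚₚ ; _≈_ = _≈_
    ; isEquivalence = record { refl = ≈-refl ; sym = ≈-sym ; trans = ≈-trans } }

  open import Algebra.Consequences.Setoid ℚₚ-setoid
    using (comm∧idˡ⇒id; comm∧invˡ⇒inv; comm∧distrʳ⇒distr)

  -- Opaque, because unfolding the operations makes definitional comparison descend into
  -- the coherence proofs of ℤₚ.
  opaque
    infixl 6 _⊕_
    infixl 7 _⊗_
    infix  8 ⊝_

    _⊕_ _⊗_ : ℚₚ → ℚₚ → ℚₚ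
    x ⊕ y = x + y
    x ⊗ y = x * y

    ⊝_ : ℚₚ → ℚₚ
    ⊝ x = - x

    ⟦_⟧ : ℤ → ℚₚ
    ⟦ a ⟧ = ι (fromℤ a)

    +-cong : ∀ {x y u v} → x ≈ y → u ≈ v → x ⊕ u ≈ y ⊕ v
    +-cong {X /p^ k} {Y /p^ l} {U /p^ m} {W /p^ o} (mk≈ (mk≈ᶻ h)) (mk≈ (mk≈ᶻ g)) =
      mk≈ (mk≈ᶻ λ n →
        mod-trans (mod-reflexive (trans
          (cong (λ t → (residue X n ℤ.* p^ m ℤ.+ residue U n ℤ.* p^ k) ℤ.* t) (p^-+ l o))
          (lem (residue X n) (residue U n) (p^ k) (p^ l) (p^ m) (p^ o))))
        (mod-trans (mod-+ (mod-* (h n) mod-refl) (mod-* (g n) mod-refl))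
        (mod-reflexive (sym (trans
          (cong (λ t → (residue Y n ℤ.* p^ o ℤ.+ residue W n ℤ.* p^ l) ℤ.* t) (p^-+ k m))
          (lem′ (residue Y n) (residue W n) (p^ k) (p^ l) (p^ m) (p^ o)))))))
      where
      lem : ∀ x u a b c d → (x ℤ.* c ℤ.+ u ℤ.* a) ℤ.* (b ℤ.* d)
                          ≡ x ℤ.* b ℤ.* (c ℤ.* d) ℤ.+ u ℤ.* d ℤ.* (a ℤ.* b)
      lem = solve-∀
      lem′ : ∀ y w a b c d → (y ℤ.* d ℤ.+ w ℤ.* b) ℤ.* (a ℤ.* c)
                           ≡ y ℤ.* a ℤ.* (c ℤ.* d) ℤ.+ w ℤ.* c ℤ.* (a ℤ.* b)
      lem′ = solve-∀

    *-cong : ∀ {x y u v} → x ≈ y → u ≈ v → x ⊗ u ≈ y ⊗ v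
    *-cong {X /p^ k} {Y /p^ l} {U /p^ m} {W /p^ o} (mk≈ (mk≈ᶻ h)) (mk≈ (mk≈ᶻ g)) =
      mk≈ (mk≈ᶻ λ n →
        mod-trans (mod-reflexive (trans
          (cong (λ t → residue X n ℤ.* residue U n ℤ.* t) (p^-+ l o))
          (lem (residue X n) (residue U n) (p^ l) (p^ o))))
        (mod-trans (mod-* (h n) (g n))
        (mod-reflexive (sym (trans
          (cong (λ t → residue Y n ℤ.* residue W n ℤ.* t) (p^-+ k m))
          (lem (residue Y n) (residue W n) (p^ k) (p^ m)))))))
      where
      lem : ∀ x u a b → x ℤ.* u ℤ.* (a ℤ.* b) ≡ x ℤ.* a ℤ.* (u ℤ.* b)
      lem = solve-∀

    -‿cong : ∀ {x y} → x ≈ y → ⊝ x ≈ ⊝ y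
    -‿cong {X /p^ k} {Y /p^ l} (mk≈ (mk≈ᶻ h)) = mk≈ (mk≈ᶻ λ n →
      mod-trans (mod-reflexive (sym (ℤ.neg-distribˡ-* (residue X n) (p^ l))))
      (mod-trans (mod-neg (h n)) (mod-reflexive (ℤ.neg-distribˡ-* (residue Y n) (p^ k)))))

    +-assoc : ∀ x y z → (x ⊕ y) ⊕ z ≈ x ⊕ (y ⊕ z)
    +-assoc (X /p^ k) (Y /p^ l) (Z /p^ m) = pointwise λ n →
      lem (residue X n) (residue Y n) (residue Z n) (p^ k) (p^ l) (p^ m)
          (p^-+ k l) (p^-+ l m)
          (trans (p^-+ k (l ℕ.+ m)) (cong (p^ k ℤ.*_) (p^-+ l m)))
          (trans (p^-+ (k ℕ.+ l) m) (cong (ℤ._* p^ m) (p^-+ k l)))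
      where
      identity : ∀ x y z a b c →
        ((x ℤ.* b ℤ.+ y ℤ.* a) ℤ.* c ℤ.+ z ℤ.* (a ℤ.* b)) ℤ.* (a ℤ.* (b ℤ.* c)) ≡
        (x ℤ.* (b ℤ.* c) ℤ.+ (y ℤ.* c ℤ.+ z ℤ.* b) ℤ.* a) ℤ.* (a ℤ.* b ℤ.* c)
      identity = solve-∀
      -- The powers with summed exponents enter as variables with equations, so that what remains is
      -- a polynomial identity in three powers of p.
      lem : ∀ x y z a b c {d e f g} →
        d ≡ a ℤ.* b → e ≡ b ℤ.* c → f ≡ a ℤ.* (b ℤ.* c) → g ≡ a ℤ.* b ℤ.* c →
        ((x ℤ.* b ℤ.+ y ℤ.* a) ℤ.* c ℤ.+ z ℤ.* d) ℤ.* f ≡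
        (x ℤ.* e ℤ.+ (y ℤ.* c ℤ.+ z ℤ.* b) ℤ.* a) ℤ.* g
      lem x y z a b c refl refl refl refl = identity x y z a b c

    +-comm : ∀ x y → x ⊕ y ≈ y ⊕ x
    +-comm (X /p^ k) (Y /p^ l) = pointwise λ n → trans
      (cong (λ t → (residue X n ℤ.* p^ l ℤ.+ residue Y n ℤ.* p^ k) ℤ.* p^ t) (ℕ.+-comm l k))
      (cong (λ t → t ℤ.* p^ (k ℕ.+ l)) (ℤ.+-comm (residue X n ℤ.* p^ l) _))

    +-identityˡ : ∀ x → ⟦ + 0 ⟧ ⊕ x ≈ x
    +-identityˡ (X /p^ k) = pointwise λ n → lem (residue X n) (p^ k)
      where
      lem : ∀ x a → (+ 0 ℤ.* a ℤ.+ x ℤ.* + 1) ℤ.* a ≡ x ℤ.* a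
      lem = solve-∀

    -‿inverseˡ : ∀ x → ⊝ x ⊕ x ≈ ⟦ + 0 ⟧
    -‿inverseˡ (X /p^ k) = pointwise λ n → lem (residue X n) (p^ k) (p^ (k ℕ.+ k))
      where
      lem : ∀ x a b → (ℤ.- x ℤ.* a ℤ.+ x ℤ.* a) ℤ.* + 1 ≡ + 0 ℤ.* b
      lem = solve-∀

    *-assoc : ∀ x y z → (x ⊗ y) ⊗ z ≈ x ⊗ (y ⊗ z)
    *-assoc (X /p^ k) (Y /p^ l) (Z /p^ m) = pointwise λ n →
      cong₂ (λ s t → s ℤ.* p^ t) (ℤ.*-assoc (residue X n) (residue Y n) (residue Z n))
        (sym (ℕ.+-assoc k l m))

    *-comm : ∀ x y → x ⊗ y ≈ y ⊗ x
    *-comm (X /p^ k) (Y /p^ l) = pointwise λ n →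
      cong₂ (λ s t → s ℤ.* p^ t) (ℤ.*-comm (residue X n) (residue Y n)) (ℕ.+-comm l k)

    *-identityˡ : ∀ x → ⟦ + 1 ⟧ ⊗ x ≈ x
    *-identityˡ (X /p^ k) = pointwise λ n → cong (ℤ._* p^ k) (ℤ.*-identityˡ (residue X n))

    *-distribʳ-+ : ∀ x y z → (y ⊕ z) ⊗ x ≈ y ⊗ x ⊕ z ⊗ x
    *-distribʳ-+ (X /p^ k) (Y /p^ l) (Z /p^ m) = pointwise λ n →
      lem (residue X n) (residue Y n) (residue Z n) (p^ k) (p^ l) (p^ m)
          (p^-+ l k) (p^-+ m k)
          (trans (p^-+ (l ℕ.+ k) (m ℕ.+ k)) (cong₂ ℤ._*_ (p^-+ l k) (p^-+ m k)))
          (trans (p^-+ (l ℕ.+ m) k) (cong (ℤ._* p^ k) (p^-+ l m)))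
      where
      identity : ∀ x y z a b c →
        (y ℤ.* c ℤ.+ z ℤ.* b) ℤ.* x ℤ.* (b ℤ.* a ℤ.* (c ℤ.* a)) ≡
        (y ℤ.* x ℤ.* (c ℤ.* a) ℤ.+ z ℤ.* x ℤ.* (b ℤ.* a)) ℤ.* (b ℤ.* c ℤ.* a)
      identity = solve-∀
      lem : ∀ x y z a b c {d e f g} →
        d ≡ b ℤ.* a → e ≡ c ℤ.* a → f ≡ b ℤ.* a ℤ.* (c ℤ.* a) → g ≡ b ℤ.* c ℤ.* a →
        (y ℤ.* c ℤ.+ z ℤ.* b) ℤ.* x ℤ.* f ≡
        (y ℤ.* x ℤ.* e ℤ.+ z ℤ.* x ℤ.* d) ℤ.* g
      lem x y z a b c refl refl refl refl = identity x y z a b c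

  ⊕-isAbelianGroup : IsAbelianGroup _≈_ _⊕_ ⟦ + 0 ⟧ ⊝_
  ⊕-isAbelianGroup = record
    { isGroup = record
      { isMonoid = record
        { isSemigroup = record
          { isMagma = record
            { isEquivalence = Setoid.isEquivalence ℚₚ-setoid
            ; ∙-cong = +-cong }
          ; assoc = +-assoc }
        ; identity = comm∧idˡ⇒id +-comm +-identityˡ }
      ; inverse = comm∧invˡ⇒inv +-comm -‿inverseˡ
      ; ⁻¹-cong = -‿cong }
    ; comm = +-comm }

  ℚₚ-commutativeRing : CommutativeRing 0ℓ 0ℓ
  ℚₚ-commutativeRing = record
    { Carrier = ℚₚ ; _≈_ = _≈_ ; _+_ = _⊕_ ; _*_ = _⊗_ ; -_ = ⊝_ ; 0# = ⟦ + 0 ⟧ ; 1# = ⟦ + 1 ⟧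
    ; isCommutativeRing = record
      { isRing = record
        { +-isAbelianGroup = ⊕-isAbelianGroup
        ; *-cong = *-cong
        ; *-assoc = *-assoc
        ; *-identity = comm∧idˡ⇒id *-comm *-identityˡ
        ; distrib = comm∧distrʳ⇒distr +-cong *-comm *-distribʳ-+ }
      ; *-comm = *-comm } }

  opaque
    unfolding _⊕_

    ⟦⟧-+ : ∀ a b → ⟦ a ℤ.+ b ⟧ ≈ ⟦ a ⟧ ⊕ ⟦ b ⟧
    ⟦⟧-+ a b = pointwise λ _ → lem a b
      where
      lem : ∀ a b → (a ℤ.+ b) ℤ.* + 1 ≡ (a ℤ.* + 1 ℤ.+ b ℤ.* + 1) ℤ.* + 1
      lem = solve-∀

    ⟦⟧-* : ∀ a b → ⟦ a ℤ.* b ⟧ ≈ ⟦ a ⟧ ⊗ ⟦ b ⟧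
    ⟦⟧-* a b = pointwise λ _ → refl

    ⟦⟧-neg : ∀ a → ⟦ ℤ.- a ⟧ ≈ ⊝ ⟦ a ⟧
    ⟦⟧-neg a = pointwise λ _ → refl

    ⟦⟧-ι : ∀ a → ⟦ a ⟧ ≈ ι (fromℤ a)
    ⟦⟧-ι a = pointwise λ _ → refl

    ι-+ : ∀ X Y → ι (X +ᶻ Y) ≈ ι X ⊕ ι Y
    ι-+ X Y = pointwise λ n → lem (residue X n) (residue Y n)
      where
      lem : ∀ a b → (a ℤ.+ b) ℤ.* + 1 ≡ (a ℤ.* + 1 ℤ.+ b ℤ.* + 1) ℤ.* + 1
      lem = solve-∀

    ι-* : ∀ X Y → ι (X *ᶻ Y) ≈ ι X ⊗ ι Y
    ι-* X Y = pointwise λ n → refl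

    ι-neg : ∀ X → ι (-ᶻ X) ≈ ⊝ ι X
    ι-neg X = pointwise λ n → refl

  ∣⇒≡0 : ∀ {n a} → p^ n ∣ a → a ≡ + 0 mod-p^ n
  ∣⇒≡0 {a = a} h = mod (by h (sym (ℤ.+-identityʳ a)))

  ≡0⇒∣ : ∀ {n a} → a ≡ + 0 mod-p^ n → p^ n ∣ a
  ≡0⇒∣ {a = a} (mod h) = by h (ℤ.+-identityʳ a)

  ℚₚ-integerAlgebra : IntegerAlgebra
  ℚₚ-integerAlgebra = record
    { commutativeRing = ℚₚ-commutativeRing
    ; fromℤ-homomorphism = record
      { ⟦_⟧    = ⟦_⟧
      ; +-homo = ⟦⟧-+
      ; *-homo = ⟦⟧-*
      ; -‿homo = ⟦⟧-neg
      ; 0-homo = ≈-refl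
      ; 1-homo = ≈-refl
      } }

  module Alg = IntegerAlgebra ℚₚ-integerAlgebra
  open Alg using (begin_; step-≈-⟩; step-≈-⟨; _∎; solve; _:=_; _:*_)

  ⊗-interchange : ∀ x y z w → (x ⊗ y) ⊗ (z ⊗ w) ≈ (x ⊗ z) ⊗ (y ⊗ w)
  ⊗-interchange = solve 4 (λ x y z w → (x :* y) :* (z :* w) := (x :* z) :* (y :* w)) ≈-refl

  -- Integer powers of p and division by them

  pos neg : ℤ → ℕ
  pos (+ n)    = n
  pos -[1+ _ ] = 0
  neg (+ _)    = 0
  neg -[1+ n ] = suc n

  pos≡+neg : ∀ i → + pos i ≡ i ℤ.+ + neg i
  pos≡+neg (+ n)    = sym (ℤ.+-identityʳ (+ n))
  pos≡+neg -[1+ n ] = sym (ℤ.+-inverseˡ (+ suc n))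

  p^-ratio : ∀ a b c d → a ℕ.+ d ≡ c ℕ.+ b → fromℤ (p^ a) /p^ b ≈ fromℤ (p^ c) /p^ d
  p^-ratio a b c d e = pointwise λ _ → trans (sym (p^-+ a d)) (trans (cong p^_ e) (p^-+ c b))

  opaque
    unfolding _⊕_

    -- The power pⁱ for i of either sign, as p to the positive part of i over p to its negative
    -- part.
    ϖ^_ : ℤ → ℚₚ
    ϖ^ i = fromℤ (p^ pos i) /p^ neg i

    ϖ*-intro : ∀ n X U → (∀ j → residue X j ≡ p^ n ℤ.* residue U j mod-p^ j) → ι X ≈ ϖ^ (+ n) ⊗ ι U
    ϖ*-intro n X U h = mk≈ (mk≈ᶻ λ j → mod-* (h j) mod-refl)

    ϖ*-elim : ∀ n X U → ι X ≈ ϖ^ (+ n) ⊗ ι U → ∀ j → residue X j ≡ p^ n ℤ.* residue U j mod-p^ j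
    ϖ*-elim n X U (mk≈ (mk≈ᶻ h)) j =
      mod-trans (mod-reflexive (sym (ℤ.*-identityʳ (residue X j))))
      (mod-trans (h j) (mod-reflexive (ℤ.*-identityʳ (p^ n ℤ.* residue U j))))

    ϖ*-integral : ∀ n U → ∃[ W ] ϖ^ (+ n) ⊗ ι U ≈ ι W
    ϖ*-integral n U = fromℤ (p^ n) *ᶻ U , pointwise λ j → refl

    ϖ^-+ : ∀ i j → ϖ^ (i ℤ.+ j) ≈ ϖ^ i ⊗ ϖ^ j
    ϖ^-+ i j = ≈-trans
      (p^-ratio (pos (i ℤ.+ j)) (neg (i ℤ.+ j)) (pos i ℕ.+ pos j) (neg i ℕ.+ neg j)
        (ℤ.+-injective exponents))
      (pointwise λ _ → cong (ℤ._* p^ (neg i ℕ.+ neg j)) (p^-+ (pos i) (pos j)))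
      where
      lem : ∀ i j a b c → i ℤ.+ j ℤ.+ c ℤ.+ (a ℤ.+ b) ≡ (i ℤ.+ a ℤ.+ (j ℤ.+ b)) ℤ.+ c
      lem = solve-∀
      exponents : + pos (i ℤ.+ j) ℤ.+ (+ neg i ℤ.+ + neg j)
                ≡ + pos i ℤ.+ + pos j ℤ.+ + neg (i ℤ.+ j)
      exponents = trans (cong (ℤ._+ (+ neg i ℤ.+ + neg j)) (pos≡+neg (i ℤ.+ j)))
        (trans (lem i j (+ neg i) (+ neg j) (+ neg (i ℤ.+ j)))
          (sym (cong₂ (λ s t → s ℤ.+ t ℤ.+ + neg (i ℤ.+ j)) (pos≡+neg i) (pos≡+neg j))))

    /p^-split : ∀ X k → X /p^ k ≈ ϖ^ (ℤ.- + k) ⊗ ι X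
    /p^-split X zero    = pointwise λ n → lem (residue X n)
      where
      lem : ∀ x → x ℤ.* + 1 ≡ + 1 ℤ.* x ℤ.* + 1
      lem = solve-∀
    /p^-split X (suc k) = pointwise λ n →
      cong₂ (λ s t → s ℤ.* p^ t) (sym (ℤ.*-identityˡ (residue X n))) (ℕ.+-identityʳ (suc k))

    ϖ^0 : ϖ^ (+ 0) ≈ ⟦ + 1 ⟧
    ϖ^0 = pointwise λ _ → refl

  ϖ^-shift : ∀ i j k x → i ≡ j ℤ.+ k → ϖ^ i ⊗ x ≈ ϖ^ j ⊗ (ϖ^ k ⊗ x)
  ϖ^-shift i j k x refl = ≈-trans (*-cong (ϖ^-+ j k) ≈-refl) (*-assoc _ _ _)

  ϖ^-identity : ∀ x → x ≈ ϖ^ (+ 0) ⊗ x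
  ϖ^-identity x = ≈-sym (≈-trans (*-cong ϖ^0 ≈-refl) (*-identityˡ x))

  -- The j-th residue of U is an exact quotient of residue j + n of X; reading X n levels further
  -- makes up for the precision lost in the division.
  divide : ∀ n X → residue X n ≡ + 0 mod-p^ n → ∃[ U ] ι X ≈ ϖ^ (+ n) ⊗ ι U
  divide n X (mod h) = mkℤₚ u u-coherent , ϖ*-intro n X (mkℤₚ u u-coherent) λ j →
    mod-trans (mod-sym (subst (λ m → residue X m ≡ residue X j mod-p^ j) (ℕ.+-comm n j)
                              (residue-mod X n j)))
              (mod-reflexive (trans (u-spec j) (ℤ.*-comm (u j) (p^ n))))
    where
    lem : ∀ a b → (a ℤ.- b) ℤ.+ (b ℤ.- + 0) ≡ a
    lem = solve-∀
    p^n∣X : ∀ j → p^ n ∣ residue X (j ℕ.+ n)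
    p^n∣X j = by (∣m∣n⇒∣m+n (p^n∣a-b (residue-mod X j n)) h) (lem (residue X (j ℕ.+ n)) (residue X n))
    u : ℕ → ℤ
    u j = quotient (p^n∣X j)
    u-spec : ∀ j → residue X (j ℕ.+ n) ≡ u j ℤ.* p^ n
    u-spec j = _∣_.equality (p^n∣X j)
    lem′ : ∀ a b c → a ℤ.* c ℤ.- b ℤ.* c ≡ (a ℤ.- b) ℤ.* c
    lem′ = solve-∀
    u-coherent : ∀ j → u (suc j) ≡ u j mod-p^ j
    u-coherent j = mod (*-cancelʳ-∣ (p^ n) {{p^-nonZero n}}
      (subst (_∣ (u (suc j) ℤ.- u j) ℤ.* p^ n) (p^-+ j n)
        (by (p^n∣a-b (coherent X (j ℕ.+ n)))
            (trans (cong₂ ℤ._-_ (u-spec (suc j)) (u-spec j)) (lem′ (u (suc j)) (u j) (p^ n))))))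

  -- The valuation in terms of powers of p

  opaque
    V : ℤ → ℚₚ → Set
    V i x = ∣ x ∣≤p^- i

    V⇒∣∣≤ : ∀ {i} x → V i x → ∣ x ∣≤p^- i
    V⇒∣∣≤ _ h = h

    ∣∣≤⇒V : ∀ {i} x → ∣ x ∣≤p^- i → V i x
    ∣∣≤⇒V _ h = h

    -- With its converse `V⇒≈ϖ*` this identifies `V i` with pⁱℤₚ, so that the laws of `V` reduce to
    -- ring identities instead of congruences.
    ≈ϖ*⇒V : ∀ {i x z} → x ≈ ϖ^ i ⊗ ι z → V i x
    ≈ϖ*⇒V {i} {X /p^ k} {z} h = aux (i ℤ.+ + k) refl
      where
      lem : ∀ k → + 0 ≡ k ℤ.- k
      lem = solve-∀
      ιX : ι X ≈ ϖ^ (i ℤ.+ + k) ⊗ ι z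
      ιX = begin
        ι X ≈⟨ ϖ^-identity (ι X) ⟩
        ϖ^ (+ 0) ⊗ ι X ≈⟨ ϖ^-shift (+ 0) (+ k) (ℤ.- + k) (ι X) (lem (+ k)) ⟩
        ϖ^ (+ k) ⊗ (ϖ^ (ℤ.- + k) ⊗ ι X) ≈⟨ *-cong ≈-refl (≈-sym (/p^-split X k)) ⟩
        ϖ^ (+ k) ⊗ (X /p^ k) ≈⟨ *-cong ≈-refl h ⟩
        ϖ^ (+ k) ⊗ (ϖ^ i ⊗ ι z) ≈⟨ ϖ^-shift (i ℤ.+ + k) (+ k) i (ι z) (ℤ.+-comm i (+ k)) ⟨
        ϖ^ (i ℤ.+ + k) ⊗ ι z ∎
      aux : ∀ e → i ℤ.+ + k ≡ e → p^ e ∣ᶻ X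
      aux -[1+ _ ] _ = tt
      aux (+ n)    e = mod-trans
        (ϖ*-elim n X z (subst (λ e → ι X ≈ ϖ^ e ⊗ ι z) e ιX) n)
        (∣⇒≡0 (∣m⇒∣m*n {m = p^ n} (residue z n) ∣-refl))

    V⇒≈ϖ* : ∀ {i x} → V i x → ∃[ z ] x ≈ ϖ^ i ⊗ ι z
    V⇒≈ϖ* {i} {X /p^ k} h = aux (i ℤ.+ + k) refl h
      where
      lem : ∀ i k → i ≡ ℤ.- k ℤ.+ (i ℤ.+ k)
      lem = solve-∀
      lem′ : ∀ i k → ℤ.- k ≡ i ℤ.+ (ℤ.- (i ℤ.+ k))
      lem′ = solve-∀
      aux : ∀ e → i ℤ.+ + k ≡ e → p^ e ∣ᶻ X → ∃[ z ] X /p^ k ≈ ϖ^ i ⊗ ι z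
      aux (+ n) e h = let U , hU = divide n X h in U , (begin
        X /p^ k                          ≈⟨ /p^-split X k ⟩
        ϖ^ (ℤ.- + k) ⊗ ι X               ≈⟨ *-cong ≈-refl hU ⟩
        ϖ^ (ℤ.- + k) ⊗ (ϖ^ (+ n) ⊗ ι U)  ≈⟨ ϖ^-shift i (ℤ.- + k) (+ n) (ι U)
                                              (trans (lem i (+ k)) (cong (λ t → ℤ.- + k ℤ.+ t) e)) ⟨
        ϖ^ i ⊗ ι U                       ∎)
      -- Here i < -k: already the denominator guarantees the bound, and the surplus power of p goes
      -- into the integral factor.
      aux -[1+ n ] e _ = let W , hW = ϖ*-integral (suc n) X in W , (begin
        X /p^ k                             ≈⟨ /p^-split X k ⟩
        ϖ^ (ℤ.- + k) ⊗ ι X                  ≈⟨ ϖ^-shift (ℤ.- + k) i (+ suc n) (ι X)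
                                                 (trans (lem′ i (+ k)) (cong (λ t → i ℤ.+ (ℤ.- t)) e)) ⟩
        ϖ^ i ⊗ (ϖ^ (+ suc n) ⊗ ι X)         ≈⟨ *-cong ≈-refl hW ⟩
        ϖ^ i ⊗ ι W    ∎)

  opaque
    unfolding _⊕_

    ι-inverse : ∀ X W → (∀ j → residue X j ℤ.* residue W j ≡ + 1 mod-p^ j) → ι X ⊗ ι W ≈ ⟦ + 1 ⟧
    ι-inverse X W h = mk≈ (mk≈ᶻ λ j → mod-* (h j) mod-refl)

  -- Units and inverses

  -- X divides p, and p divides the cofactor.
  unit-inverse : ∀ X → ¬ (residue X 1 ≡ + 0 mod-p^ 1) → ∃[ W ] ι X ⊗ ι W ≈ ⟦ + 1 ⟧
  unit-inverse X h = W , ι-inverse X W (residues {X *ᶻ W} {fromℤ (+ 1)}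
    (cancel-p^ᶻ 1 {X *ᶻ W} {fromℤ (+ 1)} (mk≈ᶻ pXW≡p)))
    where
    Q : ℤₚ
    Q = (p^ 1 ÷ X) h
    lem₁ : ∀ x q → x ℤ.* q ≡ x ℤ.* (+ 1 ℤ.* q) ℤ.* + 1
    lem₁ = solve-∀
    lem₂ : ∀ x q w → x ℤ.* w ℤ.* q ≡ x ℤ.* q ℤ.* w
    lem₂ = solve-∀
    lem₃ : ∀ a x w → a ℤ.* (x ℤ.* w) ≡ x ℤ.* (a ℤ.* w)
    lem₃ = solve-∀
    XQ≡p : ∀ j → residue X j ℤ.* residue Q j ≡ p^ 1 mod-p^ j
    XQ≡p j = mod-trans (mod-reflexive (lem₁ (residue X j) (residue Q j)))
      (mod-trans (residues (cross (⁻¹-inverseʳ (ι X) (1 , h))) j)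
        (mod-reflexive (ℤ.*-identityˡ (p^ 1))))
    ¬p∣X₁ : ¬ (+ p ∣ residue X 1)
    ¬p∣X₁ d = h (∣⇒≡0 (subst (_∣ residue X 1) (sym (ℤ.*-identityʳ (+ p))) d))
    -- If w inverts X modulo p, then Q ≡ w X Q ≡ w p ≡ 0.
    Q₁≡0 : residue Q 1 ≡ + 0 mod-p^ 1
    Q₁≡0 = let w , hw = inverse-mod-p^ (residue X 1) ¬p∣X₁ 1 in
      mod-trans (mod-reflexive (sym (ℤ.*-identityˡ (residue Q 1))))
      (mod-trans (mod-* (mod-sym hw) mod-refl)
      (mod-trans (mod-reflexive (lem₂ (residue X 1) (residue Q 1) w))
      (mod-trans (mod-* (XQ≡p 1) mod-refl)
      (∣⇒≡0 (∣m⇒∣m*n {m = p^ 1} w ∣-refl)))))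
    W : ℤₚ
    W = proj₁ (divide 1 Q Q₁≡0)
    Q≡pW : ∀ j → residue Q j ≡ p^ 1 ℤ.* residue W j mod-p^ j
    Q≡pW = ϖ*-elim 1 Q W (proj₂ (divide 1 Q Q₁≡0))
    pXW≡p : ∀ j → p^ 1 ℤ.* (residue X j ℤ.* residue W j) ≡ p^ 1 ℤ.* + 1 mod-p^ j
    pXW≡p j = mod-trans (mod-reflexive (lem₃ (p^ 1) (residue X j) (residue W j)))
      (mod-trans (mod-* (mod-refl {a = residue X j}) (mod-sym (Q≡pW j)))
      (mod-trans (XQ≡p j) (mod-reflexive (sym (ℤ.*-identityʳ (p^ 1))))))

  -- Factors p are split off while the residue modulo p vanishes, which is decidable. Each one
  -- lowers n, and at n = 0 the hypothesis is absurd because everything vanishes modulo p⁰.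
  unit-part : ∀ n X → ¬ (residue X n ≡ + 0 mod-p^ n) →
    ∃[ m ] ∃[ U ] ∃[ W ] ι X ≈ ϖ^ (+ m) ⊗ ι U × ι U ⊗ ι W ≈ ⟦ + 1 ⟧
  unit-part zero X h =
    ⊥-elim (h (∣⇒≡0 (divides (residue X 0) (sym (ℤ.*-identityʳ (residue X 0))))))
  unit-part (suc n) X h = aux (p^ 1 ∣? residue X 1)
    where
    aux : Dec (p^ 1 ∣ residue X 1) →
      ∃[ m ] ∃[ U ] ∃[ W ] ι X ≈ ϖ^ (+ m) ⊗ ι U × ι U ⊗ ι W ≈ ⟦ + 1 ⟧
    aux (no ¬p∣X₁) =
      let W , hW = unit-inverse X (λ X₁≡0 → ¬p∣X₁ (≡0⇒∣ X₁≡0)) in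
      0 , X , W , ϖ^-identity (ι X) , hW
    aux (yes p∣X₁) =
      let m , U , W , hU , hW = unit-part n Y ¬p^n∣Y in
      suc m , U , W ,
      ≈-trans X≈pY (≈-trans (*-cong ≈-refl hU) (≈-sym (ϖ^-shift (+ suc m) (+ 1) (+ m) (ι U) refl))) ,
      hW
      where
      Y : ℤₚ
      Y = proj₁ (divide 1 X (∣⇒≡0 p∣X₁))
      X≈pY : ι X ≈ ϖ^ (+ 1) ⊗ ι Y
      X≈pY = proj₂ (divide 1 X (∣⇒≡0 p∣X₁))
      ¬p^n∣Y : ¬ (residue Y n ≡ + 0 mod-p^ n)
      ¬p^n∣Y Yₙ≡0 = h (mod-trans (ϖ*-elim 1 X Y X≈pY (suc n)) (∣⇒≡0
        (by (*-monoʳ-∣ (+ p) (≡0⇒∣ (mod-trans (coherent Y n) Yₙ≡0)))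
            (cong (ℤ._* residue Y (suc n)) (sym (ℤ.*-identityʳ (+ p)))))))

  -- The axioms of a valued field for ℚₚ

  V-resp : ∀ {i x y} → x ≈ y → V i x → V i y
  V-resp x≈y h = let z , hz = V⇒≈ϖ* h in ≈ϖ*⇒V (≈-trans (≈-sym x≈y) hz)

  V-* : ∀ {i j x y} → V i x → V j y → V (i ℤ.+ j) (x ⊗ y)
  V-* {i} {j} {x} {y} hx hy =
    let z , hz = V⇒≈ϖ* hx
        w , hw = V⇒≈ϖ* hy in
    ≈ϖ*⇒V {z = z *ᶻ w} (begin
      x ⊗ y                             ≈⟨ *-cong hz hw ⟩
      (ϖ^ i ⊗ ι z) ⊗ (ϖ^ j ⊗ ι w)       ≈⟨ ⊗-interchange (ϖ^ i) (ι z) (ϖ^ j) (ι w) ⟩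
      (ϖ^ i ⊗ ϖ^ j) ⊗ (ι z ⊗ ι w)       ≈⟨ *-cong (≈-sym (ϖ^-+ i j)) (≈-sym (ι-* z w)) ⟩
      ϖ^ (i ℤ.+ j) ⊗ ι (z *ᶻ w)         ∎)

  V-+ : ∀ {i x y} → V i x → V i y → V i (x ⊕ y)
  V-+ {i} {x} {y} hx hy =
    let z , hz = V⇒≈ϖ* hx
        w , hw = V⇒≈ϖ* hy in
    ≈ϖ*⇒V {z = z +ᶻ w} (begin
      x ⊕ y                       ≈⟨ +-cong hz hw ⟩
      ϖ^ i ⊗ ι z ⊕ ϖ^ i ⊗ ι w     ≈⟨ Alg.distribˡ (ϖ^ i) (ι z) (ι w) ⟨
      ϖ^ i ⊗ (ι z ⊕ ι w)          ≈⟨ *-cong ≈-refl (≈-sym (ι-+ z w)) ⟩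
      ϖ^ i ⊗ ι (z +ᶻ w)           ∎)

  V-ι : ∀ z → V (+ 0) (ι z)
  V-ι z = ≈ϖ*⇒V (ϖ^-identity (ι z))

  V₀⇒𝐙ₚ : ∀ {x} → V (+ 0) x → 𝐙ₚ x
  V₀⇒𝐙ₚ h = let z , hz = V⇒≈ϖ* h in z , ≈-trans hz (≈-sym (ϖ^-identity (ι z)))

  𝐙ₚ⇒V₀ : ∀ {x} → 𝐙ₚ x → V (+ 0) x
  𝐙ₚ⇒V₀ (z , hz) = V-resp (≈-sym hz) (V-ι z)

  V-ϖ : ∀ i z → V i (ϖ^ i ⊗ ι z)
  V-ϖ i z = ≈ϖ*⇒V ≈-refl

  V-anti : ∀ {i j x} → j ℤ.≤ i → V i x → V j x
  V-anti {i} {j} {x} j≤i h =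
    let z , hz = V⇒≈ϖ* h
        w , hw = ϖ*-integral ℤ.∣ i ℤ.- j ∣ z in
    ≈ϖ*⇒V (begin
      x                                       ≈⟨ hz ⟩
      ϖ^ i ⊗ ι z                              ≈⟨ ϖ^-shift i j (+ ℤ.∣ i ℤ.- j ∣) (ι z) i≡ ⟩
      ϖ^ j ⊗ (ϖ^ (+ ℤ.∣ i ℤ.- j ∣) ⊗ ι z)     ≈⟨ *-cong ≈-refl hw ⟩
      ϖ^ j ⊗ ι w                              ∎)
    where
    lem : ∀ i j → i ≡ j ℤ.+ (i ℤ.- j)
    lem = solve-∀
    i≡ : i ≡ j ℤ.+ + ℤ.∣ i ℤ.- j ∣
    i≡ = trans (lem i j) (cong (λ t → j ℤ.+ t) (sym (ℤ.0≤i⇒+∣i∣≡i (ℤ.i≤j⇒0≤j-i j≤i))))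

  V-bounded : ∀ x → ∃[ i ] V i x
  V-bounded (X /p^ k) = ℤ.- + k , ≈ϖ*⇒V (/p^-split X k)

  V-ℤ : ∀ a → V (+ 0) ⟦ a ⟧
  V-ℤ a = V-resp (≈-sym (⟦⟧-ι a)) (V-ι (fromℤ a))

  1∉V₁ : ¬ V (+ 1) ⟦ + 1 ⟧
  1∉V₁ h = ¬prime[1] (subst Prime (ℕ.∣1⇒≡1 p∣1) p-prime)
    where
    1≡0 : + 1 ≡ + 0 mod-p^ 1
    1≡0 = V⇒∣∣≤ (ι (fromℤ (+ 1))) (V-resp (⟦⟧-ι (+ 1)) h)
    p^1≡ : ℤ.∣ p^ 1 ∣ ≡ p ℕ.* 1
    p^1≡ = ℤ.∣i*j∣≡∣i∣*∣j∣ (+ p) (+ 1)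
    p∣1 : p ℕ.∣ 1
    p∣1 = ℕ.∣-trans (ℕ.m∣m*n {p} 1) (subst (ℕ._∣ 1) p^1≡ (∣⇒∣ᵤ (≡0⇒∣ 1≡0)))

  -- For x = X/pᵏ with i + k ≥ 0 the refuted statement concerns a single residue of X, which is the
  -- witness `#0` asks for; for i + k < 0 there is nothing to refute.
  ∉V⇒#0 : ∀ {i} x → ¬ V i x → x #0
  ∉V⇒#0 {i} (X /p^ k) h = aux (i ℤ.+ + k) refl
    where
    aux : ∀ e → i ℤ.+ + k ≡ e → (X /p^ k) #0
    aux (+ n)    e = n , λ h′ → h (∣∣≤⇒V (X /p^ k) (subst (p^_∣ᶻ X) (sym e) h′))
    aux -[1+ n ] e = ⊥-elim (h (∣∣≤⇒V (X /p^ k) (subst (p^_∣ᶻ X) (sym e) tt)))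

  -- Being apart from zero yields the exact valuation e = m - k, expressed by the opposite bounds on
  -- x and its inverse.
  #0⇒inverse : ∀ x → x #0 → ∃[ e ] ∃[ y ] V e x × V (ℤ.- e) y × x ⊗ y ≈ ⟦ + 1 ⟧
  #0⇒inverse (X /p^ k) (n , h) =
    let m , U , W , hU , hW = unit-part n X h
        e = ℤ.- + k ℤ.+ + m
        x≈ : X /p^ k ≈ ϖ^ e ⊗ ι U
        x≈ = ≈-trans (/p^-split X k)
          (≈-trans (*-cong ≈-refl hU) (≈-sym (ϖ^-shift e (ℤ.- + k) (+ m) (ι U) refl)))
    in e , ϖ^ (ℤ.- e) ⊗ ι W , V-resp (≈-sym x≈) (V-ϖ e U) , V-ϖ (ℤ.- e) W , (begin
      (X /p^ k) ⊗ (ϖ^ (ℤ.- e) ⊗ ι W)        ≈⟨ *-cong x≈ ≈-refl ⟩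
      ϖ^ e ⊗ ι U ⊗ (ϖ^ (ℤ.- e) ⊗ ι W)       ≈⟨ ⊗-interchange (ϖ^ e) (ι U) (ϖ^ (ℤ.- e)) (ι W) ⟩
      ϖ^ e ⊗ ϖ^ (ℤ.- e) ⊗ (ι U ⊗ ι W)       ≈⟨ *-cong (≈-sym (ϖ^-+ e (ℤ.- e))) hW ⟩
      ϖ^ (e ℤ.- e) ⊗ ⟦ + 1 ⟧                ≈⟨ Alg.*-identityʳ _ ⟩
      ϖ^ (e ℤ.- e)                          ≈⟨ Alg.reflexive (cong ϖ^_ (ℤ.+-inverseʳ e)) ⟩
      ϖ^ (+ 0)                              ≈⟨ ϖ^0 ⟩
      ⟦ + 1 ⟧                               ∎)

  ∉V⇒inverse : ∀ {i x} → ¬ V i x → ∃[ y ] x ⊗ y ≈ ⟦ + 1 ⟧ × V (+ 1 ℤ.- i) y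
  ∉V⇒inverse {i} {x} h =
    let e , y , hx , hy , xy≈1 = #0⇒inverse x (∉V⇒#0 x h) in
    -- The exact valuation e lies below i, since otherwise `V i x` would hold; hence 1 - i ≤ -e.
    y , xy≈1 , V-anti (1-i≤-e e (ℤ.≰⇒> λ i≤e → h (V-anti i≤e hx))) hy
    where
    lem : ∀ e → + 1 ℤ.- (+ 1 ℤ.+ e) ≡ ℤ.- e
    lem = solve-∀
    1-i≤-e : ∀ e → e ℤ.< i → + 1 ℤ.- i ℤ.≤ ℤ.- e
    1-i≤-e e e<i = subst (+ 1 ℤ.- i ℤ.≤_) (lem e)
      (ℤ.+-monoʳ-≤ (+ 1) (ℤ.neg-mono-≤ (ℤ.i<j⇒suc[i]≤j e<i)))

  ℕ-dense : ∀ {x} → V (+ 0) x → ∀ i → ∃[ n ] V i (x ⊕ ⊝ ⟦ + n ⟧)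
  ℕ-dense {x} h i =
    let z , hz = V₀⇒𝐙ₚ h
        j = ℤ.∣ i ∣
        instance _ = p^-nonZero j
        -- The residue is an arbitrary integer, possibly negative; its remainder is a natural number
        -- in the same class.
        n = residue z j %ℕ ℤ.∣ p^ j ∣
        U , hU = divide j (z +ᶻ -ᶻ fromℤ (+ n)) (∣⇒≡0 (remainder (residue z j) (p^ j)))
    in n , V-anti (i≤+∣i∣ i) (≈ϖ*⇒V {z = U} (begin
      x ⊕ ⊝ ⟦ + n ⟧                     ≈⟨ +-cong hz (-‿cong (⟦⟧-ι (+ n))) ⟩
      ι z ⊕ ⊝ ι (fromℤ (+ n))           ≈⟨ +-cong ≈-refl (≈-sym (ι-neg (fromℤ (+ n)))) ⟩
      ι z ⊕ ι (-ᶻ fromℤ (+ n))          ≈⟨ ≈-sym (ι-+ z (-ᶻ fromℤ (+ n))) ⟩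
      ι (z +ᶻ -ᶻ fromℤ (+ n))           ≈⟨ hU ⟩
      ϖ^ (+ j) ⊗ ι U                    ∎))
    where
    i≤+∣i∣ : ∀ i → i ℤ.≤ + ℤ.∣ i ∣
    i≤+∣i∣ (+ _)    = ℤ.≤-refl
    i≤+∣i∣ -[1+ _ ] = ℤ.-≤+
    lem : ∀ a b → a ℤ.+ b ℤ.- a ≡ b
    lem = solve-∀
    remainder : ∀ a d .{{_ : ℤ.NonZero d}} → d ∣ a ℤ.- + (a %ℕ ℤ.∣ d ∣)
    remainder a d = by (∣n⇒∣m*n (a /ℕ ℤ.∣ d ∣) m∣∣m∣)
      (sym (trans (cong (λ t → t ℤ.- + (a %ℕ ℤ.∣ d ∣)) (a≡a%ℕn+[a/ℕn]*n a ℤ.∣ d ∣))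
                  (lem (+ (a %ℕ ℤ.∣ d ∣)) (a /ℕ ℤ.∣ d ∣ ℤ.* + ℤ.∣ d ∣))))

  ℚₚ-valuedField : ValuedField
  ℚₚ-valuedField = record
    { integerAlgebra = ℚₚ-integerAlgebra
    ; V         = V
    ; V-resp    = V-resp
    ; V-anti    = V-anti
    ; V-+       = V-+
    ; V-*       = V-*
    ; V-ℤ       = V-ℤ
    ; V-bounded = V-bounded
    ; 1∉V₁      = 1∉V₁
    ; inverse   = ∉V⇒inverse
    ; ℕ-dense   = ℕ-dense
    }

  -- Passage between the notions of the theorem and the valued field

  module Val = ValuedField ℚₚ-valuedField

  opaque
    unfolding _⊕_ ϖ^_

    *-⊗ : ∀ x y → x * y ≈ x ⊗ y
    *-⊗ x y = pointwise λ _ → refl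

    1+-⊕ : ∀ x → 1ℚₚ + x ≈ ⟦ + 1 ⟧ ⊕ x
    1+-⊕ x = pointwise λ _ → refl

    1++-⊕ : ∀ x y → 1ℚₚ + x + y ≈ ⟦ + 1 ⟧ ⊕ x ⊕ y
    1++-⊕ x y = pointwise λ _ → refl

    ^2*-⊗ : ∀ x y → x ^ 2 * y ≈ x ⊗ x ⊗ y
    ^2*-⊗ x y = pointwise λ n →
      cong₂ (λ s t → residue (num x) n ℤ.* s ℤ.* residue (num y) n ℤ.* p^ (exp x ℕ.+ t ℕ.+ exp y))
      (ℤ.*-identityʳ (residue (num x) n)) (sym (ℕ.+-identityʳ (exp x)))

    p*-⊗ : ∀ x → fromℕ p * x ≈ ϖ^ (+ 1) ⊗ x
    p*-⊗ x = pointwise λ n →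
      cong (λ t → t ℤ.* residue (num x) n ℤ.* p^ exp x) (sym (ℤ.*-identityʳ (+ p)))

    minus-⊕ : ∀ x y → x - y ≈ x ⊕ ⊝ y
    minus-⊕ x y = pointwise λ _ → refl

  ⁻¹-inverse : ∀ x (h : x #0) → x ⊗ (x ⁻¹) h ≈ ⟦ + 1 ⟧
  ⁻¹-inverse x h = ≈-trans (≈-sym (*-⊗ x ((x ⁻¹) h))) (≈-trans (⁻¹-inverseʳ x h) (≈-sym (⟦⟧-ι (+ 1))))

  ratios⇒ : ∀ a {q} → ratios a q → ∃[ n ] ∃[ I ] a n ⊗ I ≈ ⟦ + 1 ⟧ × q ≈ a (suc n) ⊗ I
  ratios⇒ a (n , h , hq) =
    n , (a n ⁻¹) h , ⁻¹-inverse (a n) h , ≈-trans hq (*-⊗ (a (suc n)) ((a n ⁻¹) h))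

  -- Asking for the equation with an arbitrary inverse `I` hides the particular one that `_⁻¹`
  -- builds.
  ⇒ratios : ∀ a n {q} → a n #0 → (∀ {I} → a n ⊗ I ≈ ⟦ + 1 ⟧ → q ≈ a (suc n) ⊗ I) → ratios a q
  ⇒ratios a n h f =
    n , h , ≈-trans (f (⁻¹-inverse (a n) h)) (≈-sym (*-⊗ (a (suc n)) ((a n ⁻¹) h)))

  closure⇒ : ∀ {A x} → closure A x → Val.Closure A x
  closure⇒ {x = x} h i = let a , ha , hxa = h i in a , ha , V-resp (minus-⊕ x a) (∣∣≤⇒V (x - a) hxa)

  ⇒closure : ∀ {A x} → Val.Closure A x → closure A x
  ⇒closure {x = x} h i =
    let a , ha , hxa = h i in a , ha , V⇒∣∣≤ (x - a) (V-resp (≈-sym (minus-⊕ x a)) hxa)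

  -- If v(y) ≥ j, then v(x) ≥ 1 - j would give v(1) ≥ 1.
  invertible⇒#0 : ∀ x {y} → x ⊗ y ≈ ⟦ + 1 ⟧ → x #0
  invertible⇒#0 x {y} xy≈1 =
    let j , hy = V-bounded y in
    ∉V⇒#0 {+ 1 ℤ.- j} x λ hx →
      1∉V₁ (V-resp xy≈1 (subst (λ i → V i (x ⊗ y)) (lem j) (V-* hx hy)))
    where
    lem : ∀ j → + 1 ℤ.- j ℤ.+ j ≡ + 1
    lem = solve-∀

  ⊗-invertible : ∀ {x y x′ y′} → x ⊗ x′ ≈ ⟦ + 1 ⟧ → y ⊗ y′ ≈ ⟦ + 1 ⟧ → (x ⊗ y) ⊗ (x′ ⊗ y′) ≈ ⟦ + 1 ⟧
  ⊗-invertible {x} {y} {x′} {y′} hx hy = ≈-trans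
    (⊗-interchange x y x′ y′)
    (≈-trans (*-cong hx hy) (*-identityˡ ⟦ + 1 ⟧))

  ^-invertible : ∀ {x y} → x ⊗ y ≈ ⟦ + 1 ⟧ → ∀ n → ∃[ z ] x ^ n ⊗ z ≈ ⟦ + 1 ⟧
  ^-invertible h zero = ⟦ + 1 ⟧ , ≈-trans (*-cong (≈-sym (⟦⟧-ι (+ 1))) ≈-refl) (*-identityˡ ⟦ + 1 ⟧)
  ^-invertible {x} {y} h (suc n) =
    let z , hz = ^-invertible h n in
    y ⊗ z , ≈-trans (*-cong (*-⊗ x (x ^ n)) ≈-refl) (⊗-invertible h hz)

  disc⇒ : ∀ lam r {x} → x ∈ lam *ₛ ((1ℚₚ + r) +ₛ ((r ^ 2) *ₛ 𝐙ₚ)) →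
    ∃[ z ] V (+ 0) z × x ≈ lam ⊗ (⟦ + 1 ⟧ ⊕ r ⊕ r ⊗ r ⊗ z)
  disc⇒ lam r (a , (b , (z , hz , b≈) , a≈) , x≈) =
    z , 𝐙ₚ⇒V₀ hz , ≈-trans x≈ (≈-trans (*-⊗ lam a) (*-cong ≈-refl
      (≈-trans a≈ (≈-trans (≈-trans (residuewise (λ _ → refl) refl) (1++-⊕ r b))
      (+-cong ≈-refl (≈-trans b≈ (≈-trans (residuewise (λ _ → refl) refl) (^2*-⊗ r z))))))))

  ⇒disc : ∀ lam r {x z} → V (+ 0) z → x ≈ lam ⊗ (⟦ + 1 ⟧ ⊕ r ⊕ r ⊗ r ⊗ z) →
    x ∈ lam *ₛ ((1ℚₚ + r) +ₛ ((r ^ 2) *ₛ 𝐙ₚ))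
  ⇒disc lam r {x} {z} hz x≈ = ⟦ + 1 ⟧ ⊕ r ⊕ r ⊗ r ⊗ z , (r ⊗ r ⊗ z ,
    (z , V₀⇒𝐙ₚ hz , ≈-sym (≈-trans (residuewise (λ _ → refl) refl) (^2*-⊗ r z))) ,
    ≈-sym (≈-trans (residuewise (λ _ → refl) refl) (1++-⊕ r (r ⊗ r ⊗ z)))) ,
    ≈-trans x≈ (≈-sym (*-⊗ lam (⟦ + 1 ⟧ ⊕ r ⊕ r ⊗ r ⊗ z)))

  1+p𝐙ₚ⇒ : ∀ lam {x} → x ∈ lam *ₛ (1ℚₚ +ₛ (fromℕ p *ₛ 𝐙ₚ)) →
    ∃[ t ] V (+ 1) t × x ≈ lam ⊗ (⟦ + 1 ⟧ ⊕ t)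
  1+p𝐙ₚ⇒ lam (a , (t , (b , (z , b≈) , t≈) , a≈) , x≈) =
    t ,
    V-resp
      (≈-sym (≈-trans t≈ (≈-trans (≈-trans (residuewise (λ _ → refl) refl) (p*-⊗ b))
                                  (*-cong ≈-refl b≈))))
      (V-ϖ (+ 1) z) ,
    ≈-trans x≈ (≈-trans (*-⊗ lam a) (*-cong ≈-refl
      (≈-trans a≈ (≈-trans (residuewise (λ _ → refl) refl) (1+-⊕ t)))))

  ⇒1+p𝐙ₚ : ∀ lam {x t} → V (+ 1) t → x ≈ lam ⊗ (⟦ + 1 ⟧ ⊕ t) →
    x ∈ lam *ₛ (1ℚₚ +ₛ (fromℕ p *ₛ 𝐙ₚ))
  ⇒1+p𝐙ₚ lam {t = t} ht x≈ =
    let z , t≈ = V⇒≈ϖ* ht in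
    ⟦ + 1 ⟧ ⊕ t , (t ,
      (ι z , (z , ≈-refl) , ≈-trans t≈ (≈-sym (≈-trans (residuewise (λ _ → refl) refl) (p*-⊗ (ι z))))) ,
      ≈-sym (≈-trans (residuewise (λ _ → refl) refl) (1+-⊕ t))) ,
    ≈-trans x≈ (≈-sym (*-⊗ lam (⟦ + 1 ⟧ ⊕ t)))

  -- Taking the quotient as a variable `q` keeps the division folded where the equation is used.
  *-/ : ∀ x y x#0 q → q ≡ (y / x) {x#0} → x ⊗ q ≈ y
  *-/ x y x#0 q refl = begin
    x ⊗ q
      ≈⟨ *-cong ≈-refl (≈-trans (residuewise (λ _ → refl) refl) (*-⊗ y ((x ⁻¹) x#0))) ⟩
    x ⊗ (y ⊗ (x ⁻¹) x#0)
      ≈⟨ solve 3 (λ x y d → x :* (y :* d) := y :* (x :* d)) ≈-refl x y ((x ⁻¹) x#0) ⟩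
    y ⊗ (x ⊗ (x ⁻¹) x#0)
      ≈⟨ *-cong ≈-refl (⁻¹-inverse x x#0) ⟩
    y ⊗ ⟦ + 1 ⟧
      ≈⟨ Alg.*-identityʳ y ⟩
    y ∎

  -- The Kepler set of the sequence

  module Kepler (c₁ c₂ lam : ℚₚ) (c₂#0 : c₂ #0) (lam#0 : lam #0) where
    open Val.Ratios c₁ c₂ lam ((lam ⁻¹) lam#0) (⁻¹-inverse lam lam#0)

    a : ℕ → ℚₚ
    a n = (c₁ + c₂ * fromℕ n) * lam ^ n

    opaque
      unfolding _⊕_

      a≈ : ∀ n → a n ≈ (c₁ ⊕ c₂ ⊗ ⟦ + n ⟧) ⊗ lam ^ n
      a≈ n = pointwise λ _ → refl

      a-suc≈ : ∀ n → a (suc n) ≈ (c₁ ⊕ c₂ ⊗ ⟦ + suc n ⟧) ⊗ (lam ⊗ lam ^ n)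
      a-suc≈ n = pointwise λ _ → refl

    ratios⊆Ratio : ratios a ⊆ Ratio
    ratios⊆Ratio h =
      let n , I , aₙI≈1 , q≈ = ratios⇒ a h in
      quotient⇒Ratio n
        (≈-trans (*-cong (≈-sym (a≈ n)) ≈-refl) aₙI≈1)
        (≈-trans q≈ (*-cong (a-suc≈ n) ≈-refl))

    Ratio⊆ratios : Ratio ⊆ ratios a
    Ratio⊆ratios (n , u , hu , q≈) =
      let L , hL = ^-invertible (⁻¹-inverse lam lam#0) n in
      ⇒ratios a n
        (invertible⇒#0 (a n) (≈-trans (*-cong (a≈ n) ≈-refl) (⊗-invertible hu hL)))
        λ aₙI≈1 → ≈-trans
          (Ratio⇒quotient n (≈-trans (*-cong (≈-sym (a≈ n)) ≈-refl) aₙI≈1) hu q≈)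
          (*-cong (≈-sym (a-suc≈ n)) ≈-refl)

    K⇒ : ∀ {x} → KeplerSet a x → Val.Closure Ratio x
    K⇒ h = Val.closure-mono {ratios a} {Ratio} ratios⊆Ratio (closure⇒ h)

    ⇒K : ∀ {x} → Val.Closure Ratio x → KeplerSet a x
    ⇒K h = ⇒closure (Val.closure-mono {Ratio} {ratios a} Ratio⊆ratios h)

    dominant : ∀ c₁#0 r → r ≡ (c₂ / c₁) {c₁#0} → ∣ c₂ ∣<∣ c₁ ∣ →
      KeplerSet a ≐ (lam *ₛ ((1ℚₚ + r) +ₛ ((r ^ 2) *ₛ 𝐙ₚ)))
    dominant c₁#0 r r≡c₂/c₁ (i , ∣c₂∣≤ , ∣c₁∣≰) =
      let c₁∉V : ¬ V i c₁
          c₁∉V h = ∣c₁∣≰ (V⇒∣∣≤ c₁ h)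
          c₁r≈c₂ = *-/ c₁ c₂ c₁#0 r r≡c₂/c₁
          open Dominant r ((c₁ ⁻¹) c₁#0) ((c₂ ⁻¹) c₂#0) c₁r≈c₂
                 (⁻¹-inverse c₁ c₁#0) (⁻¹-inverse c₂ c₂#0)
                 (Val.quotient∈V₁ c₁∉V (∣∣≤⇒V c₂ ∣c₂∣≤) c₁r≈c₂)
      in
      (λ h → let z , z∈V₀ , x≈ = closure⇒disc (K⇒ h) in ⇒disc lam r z∈V₀ x≈) ,
      (λ h → let z , z∈V₀ , x≈ = disc⇒ lam r h in ⇒K (disc⇒closure z∈V₀ x≈))

    subordinate : ∣ c₁ ∣≤∣ c₂ ∣ → KeplerSet a ≐ ∁ (lam *ₛ (1ℚₚ +ₛ (fromℕ p *ₛ 𝐙ₚ)))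
    subordinate c₁≤c₂ =
      let e , y , c₂∈V , y∈V , c₂y≈1 = #0⇒inverse c₂ c₂#0
          -- The comparison is used at the exact valuation e of c₂, so that c₁/c₂ gets index e - e =
          -- 0.
          c₁∈V = ∣∣≤⇒V {e} c₁ (c₁≤c₂ e (V⇒∣∣≤ c₂ c₂∈V))
          open Subordinate y c₂y≈1 (subst (λ i → V i (c₁ ⊗ y)) (ℤ.+-inverseʳ e) (V-* {e} c₁∈V y∈V))
      in
      (λ h x∈ → let t , t∈V₁ , x≈ = 1+p𝐙ₚ⇒ lam x∈ in closure⇒∉disc (K⇒ h) t∈V₁ x≈) ,
      (λ x∉ → ⇒K (∉disc⇒closure λ t∈V₁ x≈ → x∉ (⇒1+p𝐙ₚ lam t∈V₁ x≈)))

theorem1 : (p : ℕ) (p-prime : Prime p) →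
    let open PAdic p p-prime in
    (c₁ c₂ lam : ℚₚ) → c₂ #0 → lam #0 →
    let K = KeplerSet (λ n → (c₁ + c₂ * fromℕ n) * lam ^ n) in
    ((c₂<c₁ : ∣ c₂ ∣<∣ c₁ ∣) →
    let r = (c₂ / c₁) {<⇒#0 {c₂} {c₁} c₂<c₁} in
    K ≐ (lam *ₛ ((1ℚₚ + r) +ₛ ((r ^ 2) *ₛ 𝐙ₚ))))
    ×
    (∣ c₁ ∣≤∣ c₂ ∣ → K ≐ ∁ (lam *ₛ (1ℚₚ +ₛ (fromℕ p *ₛ 𝐙ₚ))))
theorem1 p p-prime c₁ c₂ lam c₂#0 lam#0 =
  -- Both inclusions are those of `dominant` and `subordinate`. Each equation passes through
  -- `residuewise`, so that the numbers in the statement and in these lemmas are matched by residues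
  -- and not by coherence proofs.
  (λ c₂<c₁ →
    (λ {x} h →
      let u , (v , (z , hz , v≈) , u≈) , x≈ =
           proj₁ (dominant (PAdic.<⇒#0 p p-prime {c₂} {c₁} c₂<c₁) _ refl c₂<c₁) {x} (λ i →
            let q , (n , aₙ#0 , q≈) , ∣x-q∣≤ = h i in
            q , (n , aₙ#0 , ≈-trans q≈ (residuewise (λ _ → refl) refl)) , ∣x-q∣≤)
      in u , (v , (z , hz , ≈-trans v≈ (residuewise (λ _ → refl) refl)) ,
                  ≈-trans u≈ (residuewise (λ _ → refl) refl)) ,
             ≈-trans x≈ (residuewise (λ _ → refl) refl)) ,
    (λ {x} (u , (v , (z , hz , v≈) , u≈) , x≈) i →
      let q , (n , aₙ#0 , q≈) , ∣x-q∣≤ =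
           proj₂ (dominant (PAdic.<⇒#0 p p-prime {c₂} {c₁} c₂<c₁) _ refl c₂<c₁) {x}
            (u , (v , (z , hz , ≈-trans v≈ (residuewise (λ _ → refl) refl)) ,
                      ≈-trans u≈ (residuewise (λ _ → refl) refl)) ,
                 ≈-trans x≈ (residuewise (λ _ → refl) refl)) i
      in q , (n , aₙ#0 , ≈-trans q≈ (residuewise (λ _ → refl) refl)) , ∣x-q∣≤)) ,
  (λ c₁≤c₂ →
    (λ {x} h (u , (v , (z , hz , v≈) , u≈) , x≈) → proj₁ (subordinate c₁≤c₂) {x}
      (λ i → let q , (n , aₙ#0 , q≈) , ∣x-q∣≤ = h i in
        q , (n , aₙ#0 , ≈-trans q≈ (residuewise (λ _ → refl) refl)) , ∣x-q∣≤)
      (u , (v , (z , hz , ≈-trans v≈ (residuewise (λ _ → refl) refl)) ,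
                ≈-trans u≈ (residuewise (λ _ → refl) refl)) ,
           ≈-trans x≈ (residuewise (λ _ → refl) refl))) ,
    (λ {x} x∉ i →
      let q , (n , aₙ#0 , q≈) , ∣x-q∣≤ = proj₂ (subordinate c₁≤c₂) {x} (λ (u , (v , (z , hz , v≈) , u≈) , x≈) →
            x∉ (u , (v , (z , hz , ≈-trans v≈ (residuewise (λ _ → refl) refl)) ,
                         ≈-trans u≈ (residuewise (λ _ → refl) refl)) ,
                    ≈-trans x≈ (residuewise (λ _ → refl) refl))) i
      in q , (n , aₙ#0 , ≈-trans q≈ (residuewise (λ _ → refl) refl)) , ∣x-q∣≤))
  where
  open Field p p-prime
  open Kepler c₁ c₂ lam c₂#0 lam#0
  open ≡ using (refl)
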